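{- In the setting described in the context, $(R,\psi)$ is a non-abelian representation of $\mathcal{S}_\theta$.
   Context: A representation of a slim partial linear space $(P,L)$ (every line has $3$ points; $x*y$ denotes the third point of the line $xy$) is a pair $(R,\psi)$, $R$ a group, $\psi$ a map from $P$ to the involutions of $R$ with (R1) $\langle\psi(P)\rangle=R$ and (R2) $\psi$ injective on each line and $\psi(x)\psi(y)=\psi(x*y)$ for each line $\{x,y,x*y\}$. It is non-abelian if $R$ is non-abelian. Let $\Delta=Q(5,2)\otimes Q(5,2)$, the unique slim dense near hexagon on $243$ points ($Q(5,2)$: generalized quadrangle of order $(2,4)$; $W(2)$: of order $(2,2)$). Known facts: any two points lie in a unique quad (convex subspace of diameter $2$), a $(3\times3)$-grid or a $Q(5,2)$; for a $Q(5,2)$-quad $Q$ and $x\notin Q$, $\pi_Q(x)$ is the unique point of $Q$ collinear with $x$ ($\pi_Q(x)=x$ if $x\in Q$), $\mathcal{R}_Q(x)$ the third point of $x\pi_Q(x)$; there are partitions $T_1,T_2$ of the points into $Q(5,2)$-quads, each element of $T_1$ meeting each element of $T_2$ in a line. Fix distinct $Q,\overline{Q}\in T_1$, $\overline{\overline{Q}}:=\mathcal{R}_Q(\overline{Q})$, $S:=\{Q\cap Q_2:Q_2\in T_2\}$ (a spread of symmetry of the quadrangle $Q$), $R_L\in T_2$ the quad containing $L\in S$, fix $L^*\in S$, $R^*:=R_{L^*}$, and let $W^0,W^1,W^2$ be the three $W(2)$-subquadrangles of $R^*$ containing the grid $R^*\cap(Q\cup\overline{Q}\cup\overline{\overline{Q}})$.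 For $L_1,L_2\in S$, $\theta(L_1,L_2)\in\mathbb{Z}_3$ is the unique element with $\pi_{R^*}\circ\pi_{R_{L_2}}\circ\pi_{R_{L_1}}(W^i)=W^{i+\theta(L_1,L_2)}$ for all $i$. Let $M^*=R^*\cap Q_1$ with $Q_1\in T_1\setminus\{Q,\overline{Q},\overline{\overline{Q}}\}$. For $x\in L^*$, $\epsilon(x):=i$ if the point of $M^*$ collinear with $x$ lies in $W^i$; for $y\in Q\setminus L^*$, $\epsilon(y):=\epsilon(x)$ with $x$ the point of $L^*$ collinear with $y$. $\mathcal{S}_\theta$ is the geometry built from the quadrangle $Q$, its spread $S$ and $\theta$: points are (P1) points $x$ of $Q$, (P2) symbols $\bar{x}$, (P3) symbols $\bar{\bar{x}}$ ($x\in Q$), (P4) triples $(x,y,i)$ with $i\in\mathbb{Z}_3$, $x,y$ distinct, $xy\in S$. Lines: (L1) lines $\{x,y,z\}$ of $Q$; (L2) $\{\bar{x},\bar{y},\bar{z}\}$, (L3) $\{\bar{\bar{x}},\bar{\bar{y}},\bar{\bar{z}}\}$ for lines $\{x,y,z\}$ of $Q$; (L4) $\{x,\bar{x},\bar{\bar{x}}\}$; for $\{a,b,c\}\in S$, $i\in\mathbb{Z}_3$: (L5) $\{a,(a,b,i),(a,c,i)\}$, (L6) $\{\bar{a},(b,a,i),(c,a,i)\}$, (L7) $\{\bar{\bar{a}},(b,c,i),(c,b,i)\}$; (L8) $\{(a,b,i),(b,c,j),(c,a,k)\}$, $\{a,b,c\}\in S$, $\{i,j,k\}=\mathbb{Z}_3$;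 (L9) $\{(a,u,i),(b,v,j),(c,w,k)\}$ with $\{a,b,c\},\{u,v,w\}$ disjoint lines of $Q$, $a\sim u$, $b\sim v$, $c\sim w$, $au,bv,cw\in S$, $j=i+\theta(au,bv)$, $k=i+\theta(au,cw)$. Let $Y$ be the set of points of types (P1)–(P3); with the lines of types (L1)–(L4) it is isomorphic to $Q(5,2)\times\mathbb{L}_3$. Let $R=2^{1+18}_-$ with $R'=\{1,\lambda\}$, written as a central product $R=M\circ N$ with $M\cong2^{1+12}_+$, $N\cong2^{1+6}_-$ (extra-special groups; $[M,N]=1$, $M\cap N=\{1,\lambda\}$). Let $(M,\phi)$ be any non-abelian representation of the geometry $Y$. Let $\delta:Q\to I_2(N)$ (involutions of $N$) be any map such that: $\delta$ is injective; $[\delta(x),\delta(y)]=1$ iff $y$ equals or is collinear with $x$; for distinct collinear $x,y$, $\delta(x*y)=\delta(x)\delta(y)$ if $xy\in S$ and $\delta(x*y)=\delta(x)\delta(y)\lambda$ otherwise; $\delta(Q)$ generates $N$. Extend $\delta$ to points of type (P4) by $\delta(a,b,j):=\delta(u)$, where $u$ is the unique point of the line $ab\in S$ with $\epsilon(u)=j$. Define $\psi$ on the points of $\mathcal{S}_\theta$ by $\psi(q):=\phi(q)$ for $q\in Y$ and $\psi(a,b,i):=\phi(b)\phi(\bar{a})\delta(a,b,i)$ for points $(a,b,i)$ of type (P4). -}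

module Defs where

open import Level using (0ℓ)
open import Data.Nat using (ℕ; zero; suc; _+_; _*_; _^_; _<_; _≤_)
open import Data.Nat.DivMod using (_mod_)
open import Data.Fin using (Fin; toℕ)
open import Data.Product using (Σ; ∃; _×_; _,_)
open import Data.Sum using (_⊎_)
open import Data.Unit using (⊤)
open import Relation.Nullary using (¬_)
open import Relation.Binary.PropositionalEquality using (_≡_; _≢_)
open import Algebra.Bundles using (Group)

_⊕_ : Fin 3 → Fin 3 → Fin 3
i ⊕ j = (toℕ i + toℕ j) mod 3

CountP : {A : Set} → (A → Set) → ℕ → Set
CountP {A} X k = Σ (Fin k → A) λ f →
  (∀ i → X (f i)) × (∀ i j → f i ≡ f j → i ≡ j) × (∀ a → X a → ∃ λ i → f i ≡ a)

_≐_ : {A : Set} → (A → Set) → (A → Set) → Set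
_≐_ {A} X Y = ∀ a → (X a → Y a) × (Y a → X a)

module Geometry {P L : Set} (inc : P → L → Set) where

  Adj : P → P → Set
  Adj x y = x ≢ y × ∃ λ l → inc x l × inc y l

  Walk : ℕ → P → P → Set
  Walk zero x y = x ≡ y
  Walk (suc n) x z = Σ P λ y → Adj x y × Walk n y z

  Dist : P → P → ℕ → Set
  Dist x y n = Walk n x y × (∀ m → m < n → ¬ Walk m x y)

  IsSlimPLS : Set
  IsSlimPLS = (∀ l → CountP (λ x → inc x l) 3)
            × (∀ x y l l′ → x ≢ y → inc x l → inc y l → inc x l′ → inc y l′ → l ≡ l′)

  IsNearPolygon : Set
  IsNearPolygon = ∀ x l → Σ P λ y → Σ ℕ λ n → inc y l × Dist x y n ×
                    (∀ z m → inc z l → z ≢ y → Dist x z m → n < m)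

  IsSlimDenseNearHexagon : Set
  IsSlimDenseNearHexagon =
      IsSlimPLS × IsNearPolygon
    × (∀ x y → Σ ℕ λ n → n ≤ 3 × Dist x y n)
    × (Σ P λ x → Σ P λ y → Dist x y 3)
    × (∀ x y → Dist x y 2 → Σ P λ z → Σ P λ z′ → z ≢ z′ × Adj x z × Adj z y × Adj x z′ × Adj z′ y)

  LineIn : (P → Set) → L → Set
  LineIn X l = ∀ x → inc x l → X x

  AdjIn : (P → Set) → P → P → Set
  AdjIn X x y = x ≢ y × ∃ λ l → LineIn X l × inc x l × inc y l

  IsGQ : ℕ → ℕ → (P → Set) → Set
  IsGQ s t X =
      (∀ l → LineIn X l → CountP (λ x → inc x l) (suc s))
    × (∀ x → X x → CountP (λ l → inc x l × LineIn X l) (suc t))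
    × (∀ x l → X x → LineIn X l → ¬ inc x l →
         Σ P λ y → (inc y l × AdjIn X x y) × (∀ y′ → inc y′ l → AdjIn X x y′ → y′ ≡ y))

  IsSubspace : (P → Set) → Set
  IsSubspace X = ∀ l x y z → x ≢ y → inc x l → inc y l → X x → X y → inc z l → X z

  IsConvex : (P → Set) → Set
  IsConvex X = ∀ x y z n m → X x → X y → Dist x z n → Dist z y m → Dist x y (n + m) → X z

  HasDiameter2 : (P → Set) → Set
  HasDiameter2 X = (∀ x y → X x → X y → Σ ℕ λ n → n ≤ 2 × Dist x y n)
                 × (Σ P λ x → Σ P λ y → X x × X y × Dist x y 2)

  IsQuad : (P → Set) → Set
  IsQuad X = IsSubspace X × IsConvex X × HasDiameter2 X

  -- quad isomorphic to Q(5,2), i.e. a generalized quadrangle of order (2,4)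
  IsQ52Quad : (P → Set) → Set
  IsQ52Quad X = IsQuad X × IsGQ 2 4 X

  Proj : (P → Set) → P → P → Set
  Proj X x y = (X x × y ≡ x) ⊎ (¬ X x × X y × Adj x y)

  Refl : (P → Set) → P → P → Set
  Refl X x z = ¬ X x × Σ P λ y → Proj X x y × z ≢ x × z ≢ y ×
               (∃ λ l → inc x l × inc y l × inc z l)

-- The setting: Δ = Q(5,2) ⊗ Q(5,2) and the data Q, Q̄, S, L*, R*, W^i, θ, M*, ε

record Setting : Set₁ where
  field
    P L : Set
    inc : P → L → Set
  open Geometry inc public
  field
    isNearHexagon : IsSlimDenseNearHexagon
    has243 : CountP {P} (λ _ → ⊤) 243
    -- the partitions T₁, T₂ of the point set into Q(5,2)-quads, given by
    -- index sets I₁, I₂ and the maps point ↦ the quad containing it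
    I₁ I₂ : Set
    t₁ : P → I₁
    t₂ : P → I₂
    T₁-quads : ∀ i → IsQ52Quad (λ x → t₁ x ≡ i)
    T₂-quads : ∀ j → IsQ52Quad (λ x → t₂ x ≡ j)
    T₁T₂-line : ∀ i j → Σ L λ l → ∀ x → (inc x l → t₁ x ≡ i × t₂ x ≡ j) × (t₁ x ≡ i × t₂ x ≡ j → inc x l)
    iQ iQ̄ : I₁
    iQ≢iQ̄ : iQ ≢ iQ̄
  Q : P → Set
  Q x = t₁ x ≡ iQ
  Q̄ : P → Set
  Q̄ x = t₁ x ≡ iQ̄
  Q̿ : P → Set
  Q̿ z = Σ P λ x → Q̄ x × Refl Q x z
  field
    -- L* ∈ S corresponds to R* ∈ T₂ (S ↔ T₂ via L ↦ R_L, Q₂ ↦ Q ∩ Q₂)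
    j* : I₂
  R* : P → Set
  R* x = t₂ x ≡ j*
  L* : P → Set
  L* x = Q x × R* x
  Grid : P → Set
  Grid x = R* x × (Q x ⊎ Q̄ x ⊎ Q̿ x)
  IsW2SubquadOfR*ContainingGrid : (P → Set) → Set
  IsW2SubquadOfR*ContainingGrid X = (∀ x → X x → R* x) × IsGQ 2 2 X × (∀ x → Grid x → X x)
  field
    W : Fin 3 → P → Set
    W-sub : ∀ i → IsW2SubquadOfR*ContainingGrid (W i)
    W-distinct : ∀ i j → W i ≐ W j → i ≡ j
    W-all : ∀ X → IsW2SubquadOfR*ContainingGrid X → Σ (Fin 3) λ i → X ≐ W i
    -- θ(L₁,L₂) (lines of S indexed by the T₂-quads R_{L₁}, R_{L₂})
    θ : I₂ → I₂ → Fin 3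
    θ-def : ∀ j₁ j₂ i → (λ z → Σ P λ w → Σ P λ y₁ → Σ P λ y₂ →
                           W i w × Proj (λ x → t₂ x ≡ j₁) w y₁ × Proj (λ x → t₂ x ≡ j₂) y₁ y₂ × Proj R* y₂ z)
                        ≐ W (i ⊕ θ j₁ j₂)
    iQ₁ : I₁
    iQ₁≢iQ : iQ₁ ≢ iQ
    iQ₁≢iQ̄ : iQ₁ ≢ iQ̄
    iQ₁≢Q̿ : Σ P λ x → t₁ x ≡ iQ₁ × ¬ Q̿ x
  M* : P → Set
  M* x = R* x × t₁ x ≡ iQ₁
  field
    -- ε (values outside Q are irrelevant)
    εQ : P → Fin 3
    ε-L* : ∀ x y → L* x → M* y → Adj x y → W (εQ x) y
    ε-Q : ∀ x y → L* x → Q y → ¬ L* y → Adj x y → εQ y ≡ εQ x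

-- The geometries Y ≅ Q(5,2) × L₃ and 𝒮_θ

module Geometries (s : Setting) where
  open Setting s

  LineQ : P → P → P → Set
  LineQ x y z = Q x × Q y × Q z × x ≢ y × y ≢ z × x ≢ z × (∃ λ l → inc x l × inc y l × inc z l)

  -- {a,b,c} is a line of the spread S
  LineS : P → P → P → Set
  LineS a b c = LineQ a b c × t₂ a ≡ t₂ b

  -- x ≠ y and the line xy belongs to S
  InS : P → P → Set
  InS x y = Q x × Q y × x ≢ y × t₂ x ≡ t₂ y

  Disjoint3 : P → P → P → P → P → P → Set
  Disjoint3 a b c u v w = ∀ x → (x ≡ a ⊎ x ≡ b ⊎ x ≡ c) → ¬ (x ≡ u ⊎ x ≡ v ⊎ x ≡ w)

  -- points of Y: x, x̄, x̿  (meaningful for x ∈ Q)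
  data YPt : Set where
    y₁ y₂ y₃ : P → YPt

  ValidY : YPt → Set
  ValidY (y₁ x) = Q x
  ValidY (y₂ x) = Q x
  ValidY (y₃ x) = Q x

  data YLine : YPt → YPt → YPt → Set where
    yL1 : ∀ {x y z} → LineQ x y z → YLine (y₁ x) (y₁ y) (y₁ z)
    yL2 : ∀ {x y z} → LineQ x y z → YLine (y₂ x) (y₂ y) (y₂ z)
    yL3 : ∀ {x y z} → LineQ x y z → YLine (y₃ x) (y₃ y) (y₃ z)
    yL4 : ∀ {x} → Q x → YLine (y₁ x) (y₂ x) (y₃ x)

  data SPt : Set where
    s₁ s₂ s₃ : P → SPt
    s₄ : P → P → Fin 3 → SPt

  ValidS : SPt → Set
  ValidS (s₁ x) = Q x
  ValidS (s₂ x) = Q x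
  ValidS (s₃ x) = Q x
  ValidS (s₄ x y i) = InS x y

  embed : YPt → SPt
  embed (y₁ x) = s₁ x
  embed (y₂ x) = s₂ x
  embed (y₃ x) = s₃ x

  data SLine : SPt → SPt → SPt → Set where
    L1 : ∀ {x y z} → LineQ x y z → SLine (s₁ x) (s₁ y) (s₁ z)
    L2 : ∀ {x y z} → LineQ x y z → SLine (s₂ x) (s₂ y) (s₂ z)
    L3 : ∀ {x y z} → LineQ x y z → SLine (s₃ x) (s₃ y) (s₃ z)
    L4 : ∀ {x} → Q x → SLine (s₁ x) (s₂ x) (s₃ x)
    L5 : ∀ {a b c i} → LineS a b c → SLine (s₁ a) (s₄ a b i) (s₄ a c i)
    L6 : ∀ {a b c i} → LineS a b c → SLine (s₂ a) (s₄ b a i) (s₄ c a i)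
    L7 : ∀ {a b c i} → LineS a b c → SLine (s₃ a) (s₄ b c i) (s₄ c b i)
    L8 : ∀ {a b c i j k} → LineS a b c → i ≢ j → j ≢ k → i ≢ k →
         SLine (s₄ a b i) (s₄ b c j) (s₄ c a k)
    L9 : ∀ {a b c u v w i j k} → LineQ a b c → LineQ u v w → Disjoint3 a b c u v w →
         Adj a u → Adj b v → Adj c w → InS a u → InS b v → InS c w →
         j ≡ i ⊕ θ (t₂ a) (t₂ b) → k ≡ i ⊕ θ (t₂ a) (t₂ c) →
         SLine (s₄ a u i) (s₄ b v j) (s₄ c w k)

module GroupTheory (G : Group 0ℓ 0ℓ) where
  open Group G

  Involution : Carrier → Set
  Involution x = (x ∙ x ≈ ε) × ¬ (x ≈ ε)

  data Gen (X : Carrier → Set) : Carrier → Set where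
    gen  : ∀ {x} → X x → Gen X x
    one  : Gen X ε
    mul  : ∀ {x y} → Gen X x → Gen X y → Gen X (x ∙ y)
    inv  : ∀ {x} → Gen X x → Gen X (x ⁻¹)
    resp : ∀ {x y} → x ≈ y → Gen X x → Gen X y

  IsSubgroup : (Carrier → Set) → Set
  IsSubgroup H = H ε × (∀ x y → H x → H y → H (x ∙ y)) × (∀ x → H x → H (x ⁻¹))
               × (∀ x y → x ≈ y → H x → H y)

  _⊆_ : (Carrier → Set) → (Carrier → Set) → Set
  A ⊆ B = ∀ x → A x → B x

  _≐G_ : (Carrier → Set) → (Carrier → Set) → Set
  A ≐G B = (A ⊆ B) × (B ⊆ A)

  HasOrder : (Carrier → Set) → ℕ → Set
  HasOrder H k = Σ (Fin k → Carrier) λ f →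
    (∀ i → H (f i)) × (∀ i j → f i ≈ f j → i ≡ j) × (∀ x → H x → ∃ λ i → x ≈ f i)

  [_,_] : Carrier → Carrier → Carrier
  [ x , y ] = x ⁻¹ ∙ y ⁻¹ ∙ x ∙ y

  Centre : (Carrier → Set) → Carrier → Set
  Centre H x = H x × (∀ h → H h → x ∙ h ≈ h ∙ x)

  Derived : (Carrier → Set) → Carrier → Set
  Derived H = Gen (λ x → Σ Carrier λ a → Σ Carrier λ b → H a × H b × x ≈ [ a , b ])

  IsMaximalSubgroupOf : (Carrier → Set) → (Carrier → Set) → Set₁
  IsMaximalSubgroupOf H K = IsSubgroup K × K ⊆ H × (Σ Carrier λ h → H h × ¬ K h)
    × (∀ K′ → IsSubgroup K′ → K ⊆ K′ → K′ ⊆ H → (K′ ⊆ K) ⊎ (H ⊆ K′))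

  Frattini : (Carrier → Set) → Carrier → Set₁
  Frattini H x = H x × (∀ K → IsMaximalSubgroupOf H K → K x)

  IsExtraspecial2 : (Carrier → Set) → ℕ → Set₁
  IsExtraspecial2 H n = IsSubgroup H × HasOrder H (2 ^ (1 + 2 * n))
    × (Centre H ≐G Derived H)
    × (∀ x → (Derived H x → Frattini H x) × (Frattini H x → Derived H x))
    × HasOrder (Centre H) 2

  -- + type: the quadratic form x ↦ x² on H/Z(H) has Witt index n, i.e.
  -- H has a subgroup of order 2^(n+1) all of whose elements square to 1
  PlusType : (Carrier → Set) → ℕ → Set₁
  PlusType H n = Σ (Carrier → Set) λ A → IsSubgroup A × A ⊆ H × HasOrder A (2 ^ (n + 1))
                 × (∀ a → A a → a ∙ a ≈ ε)

  Extraspecial+ : (Carrier → Set) → ℕ → Set₁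
  Extraspecial+ H n = IsExtraspecial2 H n × PlusType H n

  Extraspecial- : (Carrier → Set) → ℕ → Set₁
  Extraspecial- H n = IsExtraspecial2 H n × ¬ PlusType H n

  NonAbelian : (Carrier → Set) → Set
  NonAbelian H = Σ Carrier λ x → Σ Carrier λ y → H x × H y × ¬ (x ∙ y ≈ y ∙ x)

  -- (H, ψ) is a representation of the slim partial linear space with
  -- points {p ∣ Valid p} and lines given by Line (ψ takes values in G, H ≤ G)
  IsRepresentation : {Pt : Set} → (Pt → Set) → (Pt → Pt → Pt → Set) →
                     (Carrier → Set) → (Pt → Carrier) → Set
  IsRepresentation {Pt} Valid Line H ψ =
      (∀ p → Valid p → Involution (ψ p))
    × (Gen (λ x → Σ Pt λ p → Valid p × x ≈ ψ p) ≐G H)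
    × (∀ p q r → Line p q r →
         (¬ ψ p ≈ ψ q) × (¬ ψ q ≈ ψ r) × (¬ ψ p ≈ ψ r)
       × (ψ p ∙ ψ q ≈ ψ r) × (ψ q ∙ ψ p ≈ ψ r)
       × (ψ q ∙ ψ r ≈ ψ p) × (ψ r ∙ ψ q ≈ ψ p)
       × (ψ p ∙ ψ r ≈ ψ q) × (ψ r ∙ ψ p ≈ ψ q))

  IsNonAbelianRep : {Pt : Set} → (Pt → Set) → (Pt → Pt → Pt → Set) →
                    (Carrier → Set) → (Pt → Carrier) → Set
  IsNonAbelianRep Valid Line H ψ = IsRepresentation Valid Line H ψ × NonAbelian H

record GroupSetting : Set₁ where
  field
    R : Group 0ℓ 0ℓ
  open Group R public
  open GroupTheory R public
  field
    R-ext : Extraspecial- (λ _ → ⊤) 9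
    λ₀ : Carrier
    λ₀≉1 : ¬ (λ₀ ≈ ε)
    R′ : Derived (λ _ → ⊤) ≐G (λ x → (x ≈ ε) ⊎ (x ≈ λ₀))
    M N : Carrier → Set
    M-ext : Extraspecial+ M 6
    N-ext : Extraspecial- N 3
    MN-commute : ∀ m n → M m → N n → m ∙ n ≈ n ∙ m
    M∩N : (λ x → M x × N x) ≐G (λ x → (x ≈ ε) ⊎ (x ≈ λ₀))
    R=MN : ∀ r → Σ Carrier λ m → Σ Carrier λ n → M m × N n × r ≈ m ∙ n

module Construction (s : Setting) (g : GroupSetting) where
  open Setting s
  open Geometries s
  open GroupSetting g

  IsDelta : (P → Carrier) → Set
  IsDelta δ =
      (∀ x → Q x → N (δ x) × Involution (δ x))
    × (∀ x y → Q x → Q y → δ x ≈ δ y → x ≡ y)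
    × (∀ x y → Q x → Q y → (δ x ∙ δ y ≈ δ y ∙ δ x → x ≡ y ⊎ Adj x y)
                          × (x ≡ y ⊎ Adj x y → δ x ∙ δ y ≈ δ y ∙ δ x))
    × (∀ x y z → LineQ x y z → (t₂ x ≡ t₂ y → δ z ≈ δ x ∙ δ y)
                             × (t₂ x ≢ t₂ y → δ z ≈ δ x ∙ δ y ∙ λ₀))
    × (Gen (λ r → Σ P λ x → Q x × r ≈ δ x) ≐G N)

  IsPsi : (YPt → Carrier) → (P → Carrier) → (SPt → Carrier) → Set
  IsPsi φ δ ψ =
      (∀ q → ValidY q → ψ (embed q) ≈ φ q)
    × (∀ a b i u → InS a b → Q u → t₂ u ≡ t₂ a → εQ u ≡ i →
         ψ (s₄ a b i) ≈ φ (y₁ b) ∙ φ (y₂ a) ∙ δ u)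

{-# OPTIONS --safe #-}
module Submission where

-- In a slim generalized quadrangle any two non-collinear points lie in a 3×3 grid, and in a
-- grid the relations force opposite points to commute; hence φ commutes at distance at most 2
-- in Y.  Commutators lie in {1,λ}.  If φ commuted at one pair of points at distance 3 it would
-- do so at all of them, because the points of Q not collinear with a given point are connected;
-- so at distance 3 the commutator is always λ.  On a line of type (L9) this sign comes up once
-- and cancels the sign in δ(x*y) = δ(x)δ(y)λ, provided that the three points of Q at which δ is
-- evaluated form a line.  That is the identity ε(q) = ε(p) + θ(L₁,L₂) for collinear p ∈ L₁,
-- q ∈ L₂, obtained by transporting points along the projections between the quads of T₂.
-- It rests on each Wⁱ meeting M* in exactly one point: a line of Wⁱ through a point off the
-- grid meets the grid, since there are only three such lines.

open import Defs
open import Level using (0ℓ)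
open import Algebra.Bundles using (Group)
open import Data.Nat using (ℕ; zero; suc; _<_; s≤s; z≤n)
open import Data.Nat.Properties using (1+n≰n)
open import Data.Fin using (Fin; zero; suc; punchOut; _≟_)
open import Data.Fin.Properties using (all?; any?; injective⇒≤; punchOut-injective)
open import Data.Product using (Σ; ∃; _×_; _,_; proj₁; proj₂)
open import Data.Sum using (_⊎_; inj₁; inj₂)
open import Data.Empty using (⊥; ⊥-elim)
open import Data.Unit using (⊤; tt)
open import Function using (_∘_)
open import Relation.Nullary using (¬_; Dec; yes; no; ¬?)
open import Relation.Nullary.Decidable using (map′; _×-dec_; _⊎-dec_; _→-dec_; decidable-stable; toWitness)
open import Relation.Binary.PropositionalEquality using (_≡_; _≢_; refl; sym; trans; cong; cong₂; subst; ≢-sym)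
open import Relation.Binary.Definitions using (DecidableEquality)
open import Tactic.MonoidSolver using (solve)
import Algebra.Properties.Group as GroupProperties
import Relation.Binary.Reasoning.Setoid as SetoidReasoning

-- Lemmas that are analysed with `with` are abstract: otherwise their proofs get
-- normalised at every use.

abstract
  thirdIndex : ∀ (i j : Fin 3) → i ≢ j →
               Σ (Fin 3) λ k → k ≢ i × k ≢ j × (∀ m → m ≡ i ⊎ m ≡ j ⊎ m ≡ k)
  thirdIndex = toWitness {a? = all? λ i → all? λ j → ¬? (i ≟ j) →-dec
    any? λ k → ¬? (k ≟ i) ×-dec ¬? (k ≟ j) ×-dec
    all? λ m → (m ≟ i) ⊎-dec (m ≟ j) ⊎-dec (m ≟ k)} tt

  avoidTwo : ∀ (i j : Fin 5) → Σ (Fin 5) λ k → k ≢ i × k ≢ j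
  avoidTwo = toWitness {a? = all? λ i → all? λ j → any? λ k → ¬? (k ≟ i) ×-dec ¬? (k ≟ j)} tt

  fourInThree : ∀ (a b c d : Fin 3) → a ≡ b ⊎ a ≡ c ⊎ a ≡ d ⊎ b ≡ c ⊎ b ≡ d ⊎ c ≡ d
  fourInThree = toWitness {a? = all? λ a → all? λ b → all? λ c → all? λ d →
    (a ≟ b) ⊎-dec (a ≟ c) ⊎-dec (a ≟ d) ⊎-dec (b ≟ c) ⊎-dec (b ≟ d) ⊎-dec (c ≟ d)} tt

  -- A missed value `k` could be punched out of the codomain, leaving an injection of `Fin (suc n)`
  -- into `Fin n`.
  injective⇒surjective : ∀ {n} (f : Fin n → Fin n) → (∀ i j → f i ≡ f j → i ≡ j) →
                         ∀ k → ∃ λ i → f i ≡ k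
  injective⇒surjective {suc n} f inj k = decidable-stable (any? λ i → f i ≟ k) λ missed →
    let k≢f : ∀ i → k ≢ f i
        k≢f i k≡fi = missed (i , sym k≡fi)
    in 1+n≰n (injective⇒≤ {f = λ i → punchOut (k≢f i)}
         λ {i} {j} eq → inj i j (punchOut-injective (k≢f i) (k≢f j) eq))

-- Collinearity and distance in the near hexagon

module Collinearity (s : Setting) where
  open Setting s

  private
    pointCode : P → Fin 243
    pointCode x = proj₁ (proj₂ (proj₂ (proj₂ has243)) x tt)

    decode : ∀ x → proj₁ has243 (pointCode x) ≡ x
    decode x = proj₂ (proj₂ (proj₂ (proj₂ has243)) x tt)

  -- Points are compared through their codes in the enumeration of the 243 points.
  _≟P_ : DecidableEquality P
  x ≟P y = map′ (λ eq → trans (sym (decode x)) (trans (cong (proj₁ has243) eq) (decode y)))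
                (cong pointCode) (pointCode x ≟ pointCode y)

  inc? : ∀ x l → Dec (inc x l)
  inc? x l with proj₁ (proj₁ isNearHexagon) l
  ... | f , f-on , _ , f-onto with any? (λ i → f i ≟P x)
  ... | yes (i , fi≡x) = yes (subst (λ z → inc z l) fi≡x (f-on i))
  ... | no ¬i = no (¬i ∘ f-onto x)

  lineThrough : ∀ {x y l l′} → x ≢ y → inc x l → inc y l → inc x l′ → inc y l′ → l ≡ l′
  lineThrough = proj₂ (proj₁ isNearHexagon) _ _ _ _

  abstract
    thirdPoint : ∀ {x y l} → x ≢ y → inc x l → inc y l →
                 Σ P λ z → inc z l × z ≢ x × z ≢ y × (∀ w → inc w l → w ≡ x ⊎ w ≡ y ⊎ w ≡ z)
    thirdPoint {x} {y} {l} x≢y x∈l y∈l with proj₁ (proj₁ isNearHexagon) l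
    ... | f , f-on , f-inj , f-onto with f-onto x x∈l | f-onto y y∈l
    ... | i , refl | j , refl with thirdIndex i j (x≢y ∘ cong f)
    ... | k , k≢i , k≢j , cover = f k , f-on k , k≢i ∘ f-inj k i , k≢j ∘ f-inj k j , covered
      where
      covered : ∀ w → inc w l → w ≡ f i ⊎ w ≡ f j ⊎ w ≡ f k
      covered w w∈l with f-onto w w∈l
      ... | m , refl with cover m
      ... | inj₁ m≡i = inj₁ (cong f m≡i)
      ... | inj₂ (inj₁ m≡j) = inj₂ (inj₁ (cong f m≡j))
      ... | inj₂ (inj₂ m≡k) = inj₂ (inj₂ (cong f m≡k))

  lineMembers : ∀ {x y z l} → x ≢ y → y ≢ z → x ≢ z → inc x l → inc y l → inc z l →
                ∀ w → inc w l → w ≡ x ⊎ w ≡ y ⊎ w ≡ z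
  lineMembers x≢y y≢z x≢z x∈l y∈l z∈l w w∈l with thirdPoint x≢y x∈l y∈l
  ... | t , _ , _ , _ , cover with cover w w∈l | cover _ z∈l
  ... | inj₁ w≡x | _ = inj₁ w≡x
  ... | inj₂ (inj₁ w≡y) | _ = inj₂ (inj₁ w≡y)
  ... | inj₂ (inj₂ _) | inj₁ z≡x = ⊥-elim (x≢z (sym z≡x))
  ... | inj₂ (inj₂ _) | inj₂ (inj₁ z≡y) = ⊥-elim (y≢z (sym z≡y))
  ... | inj₂ (inj₂ w≡t) | inj₂ (inj₂ z≡t) = inj₂ (inj₂ (trans w≡t (sym z≡t)))

  Adj-sym : ∀ {x y} → Adj x y → Adj y x
  Adj-sym (x≢y , l , x∈l , y∈l) = ≢-sym x≢y , l , y∈l , x∈l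

  dist1 : ∀ {x y} → Adj x y → Dist x y 1
  dist1 {x} {y} adj = (y , adj , refl) , λ { zero _ x≡y → proj₁ adj x≡y ; (suc _) (s≤s ()) _ }

  dist2 : ∀ {x y z} → Adj x y → Adj y z → x ≢ z → ¬ Adj x z → Dist x z 2
  dist2 {x} {y} {z} xy yz x≢z ¬xz = (y , xy , z , yz , refl) , λ
    { zero _ x≡z → x≢z x≡z
    ; (suc zero) _ (_ , adj , refl) → ¬xz adj
    ; (suc (suc _)) (s≤s (s≤s ())) _ }

  -- The near hexagon axioms supply the distance of the two points, and minimality of a distance of
  -- 2 or more excludes a walk of length 1.
  Adj? : ∀ x y → Dec (Adj x y)
  Adj? x y with proj₁ (proj₂ (proj₂ isNearHexagon)) x y
  ... | zero , _ , x≡y , _ = no λ adj → proj₁ adj x≡y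
  ... | suc zero , _ , (_ , adj , refl) , _ = yes adj
  ... | suc (suc n) , _ , _ , shorter = no λ adj → shorter 1 (s≤s (s≤s z≤n)) (y , adj , refl)

  Col : P → P → Set
  Col x y = x ≡ y ⊎ Adj x y

  Col-sym : ∀ {x y} → Col x y → Col y x
  Col-sym (inj₁ x≡y) = inj₁ (sym x≡y)
  Col-sym (inj₂ adj) = inj₂ (Adj-sym adj)

  Col? : ∀ x y → Dec (Col x y)
  Col? x y = (x ≟P y) ⊎-dec Adj? x y

  ≢⇒Adj : ∀ {x y} → x ≢ y → Col x y → Adj x y
  ≢⇒Adj x≢y (inj₁ x≡y) = ⊥-elim (x≢y x≡y)
  ≢⇒Adj x≢y (inj₂ adj) = adj

  onLine⇒Col : ∀ {x y l} → inc x l → inc y l → Col x y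
  onLine⇒Col {x} {y} {l} x∈l y∈l with x ≟P y
  ... | yes x≡y = inj₁ x≡y
  ... | no x≢y = inj₂ (x≢y , l , x∈l , y∈l)

  -- The line has a unique point `o` nearest to `p`. One of `a`, `b` differs from `o`; if it is at
  -- distance 1 from `p`, then `o` is at distance 0, so `p` is on the line.
  noTriangles : ∀ {p a b l} → a ≢ b → inc a l → inc b l → Col p a → Col p b → inc p l
  noTriangles a≢b a∈l b∈l (inj₁ refl) _ = a∈l
  noTriangles a≢b a∈l b∈l (inj₂ _) (inj₁ refl) = b∈l
  noTriangles {p} {a} {b} {l} a≢b a∈l b∈l (inj₂ pa) (inj₂ pb) with proj₁ (proj₂ isNearHexagon) p l
  ... | o , n , o∈l , p-o , farther = on (a ≟P o)
    where
    at0 : ∀ {m} → m < 1 → Walk m p o → inc p l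
    at0 (s≤s z≤n) refl = o∈l
    on : Dec (a ≡ o) → inc p l
    on (no a≢o) = at0 (farther a 1 a∈l a≢o (dist1 pa)) (proj₁ p-o)
    on (yes refl) = at0 (farther b 1 b∈l (≢-sym a≢b) (dist1 pb)) (proj₁ p-o)

  -- Two distinct neighbours of `p` in the quad would force `p` into it: by the subspace property if
  -- they are collinear, by convexity if they are at distance 2.
  uniqueNeighbour : ∀ {X} → IsQuad X → ∀ {p x y} → ¬ X p → X x → X y → Adj p x → Adj p y → x ≡ y
  uniqueNeighbour (isSub , isConv , diam , _) {p} {x} {y} p∉X x∈X y∈X px py with diam x y x∈X y∈X
  ... | zero , _ , x≡y , _ = x≡y
  ... | suc zero , _ , (_ , (x≢y , l , x∈l , y∈l) , refl) , _ =
        ⊥-elim (p∉X (isSub l x y p x≢y x∈l y∈l x∈X y∈X (noTriangles x≢y x∈l y∈l (inj₂ px) (inj₂ py))))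
  ... | suc (suc zero) , _ , xy2 =
        ⊥-elim (p∉X (isConv x y p 1 1 x∈X y∈X (dist1 (Adj-sym px)) (dist1 py) xy2))
  ... | suc (suc (suc _)) , s≤s (s≤s ()) , _

-- Generalized quadrangles of order (2,4)

module Quadrangle (s : Setting) (X : Setting.P s → Set) (isQ : Setting.IsQ52Quad s X) where
  open Setting s
  open Collinearity s

  private
    isSub = proj₁ (proj₁ isQ)

  Line : P → P → P → Set
  Line x y z = X x × X y × X z × x ≢ y × y ≢ z × x ≢ z × (∃ λ l → inc x l × inc y l × inc z l)

  swap : ∀ {x y z} → Line x y z → Line y x z
  swap (a , b , c , p , q , r , l , u , v , w) = b , a , c , ≢-sym p , r , q , l , v , u , w

  rotate : ∀ {x y z} → Line x y z → Line y z x
  rotate (a , b , c , p , q , r , l , u , v , w) = b , c , a , q , ≢-sym r , ≢-sym p , l , v , w , u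

  lineIn : ∀ {x y l} → x ≢ y → inc x l → inc y l → X x → X y → LineIn X l
  lineIn x≢y x∈l y∈l x∈X y∈X z z∈l = isSub _ _ _ z x≢y x∈l y∈l x∈X y∈X z∈l

  abstract
    completeLine : ∀ {x y l} → inc x l → inc y l → x ≢ y → X x → X y → ∃ λ z → Line x y z × inc z l
    completeLine x∈l y∈l x≢y x∈X y∈X with thirdPoint x≢y x∈l y∈l
    ... | z , z∈l , z≢x , z≢y , _ = z ,
          (x∈X , y∈X , lineIn x≢y x∈l y∈l x∈X y∈X z z∈l , x≢y , ≢-sym z≢y , ≢-sym z≢x , _ , x∈l , y∈l , z∈l) , z∈l

    third : ∀ {x y} → X x → X y → Adj x y → ∃ λ z → Line x y z
    third x∈X y∈X (x≢y , l , x∈l , y∈l) with completeLine x∈l y∈l x≢y x∈X y∈X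
    ... | z , xyz , _ = z , xyz

  Line⇒Adj : ∀ {x y z} → Line x y z → Adj x y
  Line⇒Adj (_ , _ , _ , x≢y , _ , _ , l , x∈l , y∈l , _) = x≢y , l , x∈l , y∈l

  Line⇒Col : ∀ {x y z} → Line x y z → Col x y
  Line⇒Col = inj₂ ∘ Line⇒Adj

  col-third : ∀ {p x y z} → Line x y z → Col p x → Col p y → Col p z
  col-third (_ , _ , _ , x≢y , _ , _ , l , x∈l , y∈l , z∈l) px py =
    onLine⇒Col (noTriangles x≢y x∈l y∈l px py) z∈l

  -- The quadrangle axiom as a three-way case split, with the points of the line itself included.
  near : ∀ {p x y z} → Line x y z → X p → Col p x ⊎ Col p y ⊎ Col p z
  near {p} (x∈X , y∈X , _ , x≢y , y≢z , x≢z , l , x∈l , y∈l , z∈l) p∈X with inc? p l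
  ... | yes p∈l = inj₁ (onLine⇒Col p∈l x∈l)
  ... | no p∉l with proj₂ (proj₂ (proj₂ isQ)) p l p∈X (lineIn x≢y x∈l y∈l x∈X y∈X) p∉l
  ... | w , (w∈l , p≢w , k , _ , p∈k , w∈k) , _ with lineMembers x≢y y≢z x≢z x∈l y∈l z∈l w w∈l
  ... | inj₁ refl = inj₁ (inj₂ (p≢w , k , p∈k , w∈k))
  ... | inj₂ (inj₁ refl) = inj₂ (inj₁ (inj₂ (p≢w , k , p∈k , w∈k)))
  ... | inj₂ (inj₂ refl) = inj₂ (inj₂ (inj₂ (p≢w , k , p∈k , w∈k)))

  private
    fillLine : ∀ {a k} → inc a k → LineIn X k → Σ P λ b → Σ P λ b′ → Line a b b′ × inc b k × inc b′ k
    fillLine {a} {k} a∈k k⊆X with proj₁ (proj₂ isQ) k k⊆X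
    ... | f , f-on , f-inj , _ = go (a ≟P f zero)
      where
      with₂ : ∀ {b} → a ≢ b → inc b k → Σ P λ b → Σ P λ b′ → Line a b b′ × inc b k × inc b′ k
      with₂ {b} a≢b b∈k with completeLine a∈k b∈k a≢b (k⊆X a a∈k) (k⊆X b b∈k)
      ... | b′ , abb′ , b′∈k = b , b′ , abb′ , b∈k , b′∈k
      0≢1 : f zero ≢ f (suc zero)
      0≢1 eq with f-inj _ _ eq
      ... | ()
      go : Dec (a ≡ f zero) → Σ P λ b → Σ P λ b′ → Line a b b′ × inc b k × inc b′ k
      go (no a≢) = with₂ a≢ (f-on zero)
      go (yes refl) = with₂ 0≢1 (f-on (suc zero))

  abstract
    anyLine : ∀ {a} → X a → Σ P λ b → Σ P λ b′ → Line a b b′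
    anyLine {a} a∈X with proj₁ (proj₂ (proj₂ isQ)) a a∈X
    ... | f , f-on , _ with fillLine (proj₁ (f-on zero)) (proj₂ (f-on zero))
    ... | b , b′ , abb′ , _ = b , b′ , abb′

    -- Of the five lines through `a` one differs from both `au` and `av`. A point of it other than
    -- `a` that was collinear with `u` or `v` would close a triangle. The choice `u = v` is allowed
    -- and is used below.
    avoidingLine : ∀ {a u v} → X a → X u → X v → Adj a u → Adj a v →
                   Σ P λ b → Σ P λ b′ → Line a b b′ × (¬ Col b u × ¬ Col b′ u) × (¬ Col b v × ¬ Col b′ v)
    avoidingLine {a} {u} {v} a∈X u∈X v∈X (a≢u , l₁ , a∈l₁ , u∈l₁) (a≢v , l₂ , a∈l₂ , v∈l₂)
      with proj₁ (proj₂ (proj₂ isQ)) a a∈X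
    ... | f , f-on , f-inj , f-onto
      with f-onto l₁ (a∈l₁ , lineIn a≢u a∈l₁ u∈l₁ a∈X u∈X) | f-onto l₂ (a∈l₂ , lineIn a≢v a∈l₂ v∈l₂ a∈X v∈X)
    ... | i , refl | j , refl with avoidTwo i j
    ... | k , k≢i , k≢j with fillLine (proj₁ (f-on k)) (proj₂ (f-on k))
    ... | b , b′ , abb′@(_ , _ , _ , a≢b , _ , a≢b′ , _) , b∈k , b′∈k =
          b , b′ , abb′ , (off k≢i a≢u a∈l₁ u∈l₁ a≢b b∈k , off k≢i a≢u a∈l₁ u∈l₁ a≢b′ b′∈k)
                        , (off k≢j a≢v a∈l₂ v∈l₂ a≢b b∈k , off k≢j a≢v a∈l₂ v∈l₂ a≢b′ b′∈k)
      where
      off : ∀ {m w c} → k ≢ m → a ≢ w → inc a (f m) → inc w (f m) → a ≢ c → inc c (f k) → ¬ Col c w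
      off k≢m a≢w a∈m w∈m a≢c c∈k cw = k≢m (f-inj _ _
        (lineThrough a≢c (proj₁ (f-on k)) c∈k a∈m
          (noTriangles a≢w a∈m w∈m (onLine⇒Col c∈k (proj₁ (f-on k))) cw)))

    nonCollinear : ∀ {x} → X x → ∃ λ y → X y × ¬ Col x y
    nonCollinear x∈X with anyLine x∈X
    ... | b , _ , xbb′@(_ , b∈X , _) with avoidingLine b∈X x∈X x∈X (Adj-sym (Line⇒Adj xbb′)) (Adj-sym (Line⇒Adj xbb′))
    ... | c , _ , (_ , c∈X , _) , (¬cx , _) , _ = c , c∈X , ¬cx ∘ Col-sym

  -- Every line through `x` carries a neighbour of `y`. Taking the second line by `avoidingLine`
  -- makes the two neighbours non-collinear.
  commonNeighbours : ∀ {x y} → X x → X y → ¬ Col x y →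
    Σ P λ a → Σ P λ a′ → Σ P λ b → Σ P λ b′ → Line x a a′ × Line x b b′ × Adj y a × Adj y b × ¬ Col a b
  commonNeighbours {x} {y} x∈X y∈X ¬xy with anyLine x∈X
  ... | c , c′ , xcc′ = first (near xcc′ y∈X)
    where
    Goal : Set
    Goal = Σ P λ a → Σ P λ a′ → Σ P λ b → Σ P λ b′ →
           Line x a a′ × Line x b b′ × Adj y a × Adj y b × ¬ Col a b
    adj : ∀ {a a′} → Line x a a′ → Col y a → Adj y a
    adj xaa′ (inj₁ refl) = ⊥-elim (¬xy (Line⇒Col xaa′))
    adj _ (inj₂ ya) = ya
    second : ∀ {a a′} → Line x a a′ → Adj y a → Goal
    second {a} {a′} xaa′@(_ , a∈X , _) ya with avoidingLine x∈X a∈X a∈X (Line⇒Adj xaa′) (Line⇒Adj xaa′)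
    ... | b , b′ , xbb′ , (¬ba , ¬b′a) , _ with near xbb′ y∈X
    ... | inj₁ yx = ⊥-elim (¬xy (Col-sym yx))
    ... | inj₂ (inj₁ yb) = a , a′ , b , b′ , xaa′ , xbb′ , ya , adj xbb′ yb , ¬ba ∘ Col-sym
    ... | inj₂ (inj₂ yb′) = a , a′ , b′ , b , xaa′ , swap (rotate (rotate xbb′)) , ya
                          , adj (swap (rotate (rotate xbb′))) yb′ , ¬b′a ∘ Col-sym
    first : Col y x ⊎ Col y c ⊎ Col y c′ → Goal
    first (inj₁ yx) = ⊥-elim (¬xy (Col-sym yx))
    first (inj₂ (inj₁ yc)) = second xcc′ (adj xcc′ yc)
    first (inj₂ (inj₂ yc′)) = second (swap (rotate (rotate xcc′))) (adj (swap (rotate (rotate xcc′))) yc′)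

  -- A point of the third row is collinear with some point of each column, and the
  -- points of the first two rows are excluded.
  gridRow : ∀ {a b c u v w a′ b′ c′} → Line a b c → Line u v w →
            Line a u a′ → Line b v b′ → Line c w c′ →
            ¬ Col a v → ¬ Col a w → ¬ Col b u → ¬ Col b w → ¬ Col c u → ¬ Col c v → Line a′ b′ c′
  gridRow abc uvw aua′ bvb′ cwc′ ¬av ¬aw ¬bu ¬bw ¬cu ¬cv =
    row (side abc uvw aua′ bvb′ ¬av ¬bu)
        (side (rotate abc) (rotate uvw) bvb′ cwc′ ¬bw ¬cv)
        (side (swap (rotate (rotate abc))) (swap (rotate (rotate uvw))) aua′ cwc′ ¬aw ¬cu)
    where
    side : ∀ {a b c u v w a′ b′} → Line a b c → Line u v w → Line a u a′ → Line b v b′ →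
           ¬ Col a v → ¬ Col b u → X a′ × X b′ × Adj a′ b′
    side {a} {b} {u = u} {v} {a′ = a′} {b′} abc uvw aua′ bvb′ ¬av ¬bu =
      a′∈X , b′∈X , ≢⇒Adj a′≢b′ (excluded (near bvb′ a′∈X))
      where
      a′∈X = proj₁ (proj₂ (proj₂ aua′))
      b′∈X = proj₁ (proj₂ (proj₂ bvb′))
      ¬a′b : ¬ Col a′ b
      ¬a′b a′b = ¬bu (col-third (rotate (rotate aua′)) (Col-sym a′b) (Line⇒Col (swap abc)))
      ¬a′v : ¬ Col a′ v
      ¬a′v a′v = ¬av (Col-sym (col-third (rotate aua′) (Line⇒Col (swap uvw)) (Col-sym a′v)))
      excluded : Col a′ b ⊎ Col a′ v ⊎ Col a′ b′ → Col a′ b′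
      excluded (inj₁ a′b) = ⊥-elim (¬a′b a′b)
      excluded (inj₂ (inj₁ a′v)) = ⊥-elim (¬a′v a′v)
      excluded (inj₂ (inj₂ a′b′)) = a′b′
      a′≢b′ : a′ ≢ b′
      a′≢b′ refl = ¬a′v (Col-sym (Line⇒Col (rotate bvb′)))
    row : ∀ {a′ b′ c′} → X a′ × X b′ × Adj a′ b′ → X b′ × X c′ × Adj b′ c′ → X a′ × X c′ × Adj a′ c′ → Line a′ b′ c′
    row (a∈X , b∈X , a≢b , l , a∈l , b∈l) (_ , c∈X , bc) (_ , _ , ac) =
      a∈X , b∈X , c∈X , a≢b , proj₁ bc , proj₁ ac , l , a∈l , b∈l ,
      noTriangles a≢b a∈l b∈l (inj₂ (Adj-sym ac)) (inj₂ (Adj-sym bc))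

  -- The array with rows `a x p`, `y b q`, `r t z`, whose columns are lines as well. The given
  -- points `x` and `y` occupy two places exchanged by transposition, as `grid⇒comm` requires.
  record Grid3 (x y : P) : Set where
    field
      {a b p q r t z} : P
      row₁ : Line a x p
      row₂ : Line y b q
      row₃ : Line r t z
      col₁ : Line a y r
      col₂ : Line x b t
      col₃ : Line p q z

  -- Two non-collinear common neighbours `a`, `b` of `x` and `y` span the grid: `p`, `t`, `r`, `q`
  -- complete the four sides, `p` is collinear with `q` because `y` and `b` are excluded, and
  -- `gridRow` closes the last row.
  gridOn : ∀ {x y} → X x → X y → ¬ Col x y → Grid3 x y
  gridOn {x} {y} x∈X y∈X ¬xy with commonNeighbours x∈X y∈X ¬xy
  ... | a , p , b , t , xap , xbt , ya , yb , ¬ab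
    with third (proj₁ (proj₂ xap)) y∈X (Adj-sym ya) | third y∈X (proj₁ (proj₂ xbt)) yb
  ... | r , ayr | q , ybq = finish (≢⇒Adj p≢q (excluded (near ybq p∈X)))
    where
    p∈X = proj₁ (proj₂ (proj₂ xap))
    q∈X = proj₁ (proj₂ (proj₂ ybq))
    ¬py : ¬ Col p y
    ¬py py = ¬xy (Col-sym (col-third (rotate xap) (inj₂ ya) (Col-sym py)))
    ¬pb : ¬ Col p b
    ¬pb pb = ¬ab (Col-sym (col-third (rotate (rotate xap)) (Col-sym pb) (Line⇒Col (swap xbt))))
    excluded : Col p y ⊎ Col p b ⊎ Col p q → Col p q
    excluded (inj₁ py) = ⊥-elim (¬py py)
    excluded (inj₂ (inj₁ pb)) = ⊥-elim (¬pb pb)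
    excluded (inj₂ (inj₂ pq)) = pq
    p≢q : p ≢ q
    p≢q refl = ¬pb (Line⇒Col (swap (rotate ybq)))
    finish : Adj p q → Grid3 x y
    finish pq with third p∈X q∈X pq
    ... | z , pqz = record
      { row₁ = swap xap ; row₂ = ybq ; col₁ = ayr ; col₂ = xbt ; col₃ = pqz
      ; row₃ = gridRow (swap xap) ybq ayr xbt pqz ¬ab
                 (λ aq → ¬ab (col-third (rotate (rotate ybq)) aq (inj₂ (Adj-sym ya))))
                 ¬xy
                 (λ xq → ¬xy (col-third (rotate ybq) (Line⇒Col xbt) xq))
                 ¬py ¬pb }

  -- A symmetric relation whose sections are subspaces containing the collinear
  -- points relates either no non-collinear pair or every pair: the points not
  -- collinear with a given point form a connected set.
  module Spread
    (F : P → P → Set)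
    (F-sym : ∀ {x y} → X x → X y → F x y → F y x)
    (F-col : ∀ {x y} → X x → X y → Col x y → F x y)
    (F-line : ∀ {x y y′ z} → X x → Line y y′ z → F x y → F x y′ → F x z)
    where

    private
      -- If `y` and `y′` are distinct, the third point of their line is the one collinear with `x`,
      -- so `F-col` holds there and `F-line` carries the relation from `y` to `y′`.
      step : ∀ {x y y′} → X x → X y → X y′ → ¬ Col x y → ¬ Col x y′ → Col y y′ → F x y → F x y′
      step x∈X y∈X y′∈X ¬xy ¬xy′ (inj₁ refl) xy = xy
      step x∈X y∈X y′∈X ¬xy ¬xy′ (inj₂ yy′) xy with third y∈X y′∈X yy′
      ... | z , yy′z with near yy′z x∈X
      ... | inj₁ c = ⊥-elim (¬xy c)
      ... | inj₂ (inj₁ c) = ⊥-elim (¬xy′ c)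
      ... | inj₂ (inj₂ c) = F-line x∈X (rotate (rotate yy′z)) (F-col x∈X (proj₁ (proj₂ (proj₂ yy′z))) c) xy

      -- For non-collinear `y`, `y′` the path goes through a common neighbour not collinear with
      -- `x`. If `x` is collinear with both `a` and `b`, the path is `y`, `a′`, `d`, `y′`, where
      -- `a′` and `d` complete the lines `ya` and `by′`.
      fan : ∀ {x y y′} → X x → X y → X y′ → ¬ Col x y → ¬ Col x y′ → F x y → F x y′
      fan {x} {y} {y′} x∈X y∈X y′∈X ¬xy ¬xy′ xy with Col? y y′
      ... | yes yy′ = step x∈X y∈X y′∈X ¬xy ¬xy′ yy′ xy
      ... | no ¬yy′ with commonNeighbours y∈X y′∈X ¬yy′
      ... | a , a′ , b , b′ , yaa′ , ybb′ , y′a , y′b , ¬ab = via (Col? x a) (Col? x b)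
        where
        a∈X = proj₁ (proj₂ yaa′)
        a′∈X = proj₁ (proj₂ (proj₂ yaa′))
        b∈X = proj₁ (proj₂ ybb′)
        via : Dec (Col x a) → Dec (Col x b) → F x y′
        via (no ¬xa) _ = step x∈X a∈X y′∈X ¬xa ¬xy′ (inj₂ (Adj-sym y′a))
                           (step x∈X y∈X a∈X ¬xy ¬xa (Line⇒Col yaa′) xy)
        via (yes _) (no ¬xb) = step x∈X b∈X y′∈X ¬xb ¬xy′ (inj₂ (Adj-sym y′b))
                                 (step x∈X y∈X b∈X ¬xy ¬xb (Line⇒Col ybb′) xy)
        via (yes xa) (yes xb) with third b∈X y′∈X (Adj-sym y′b)
        ... | d , by′d = step x∈X d∈X y′∈X ¬xd ¬xy′ (Col-sym (Line⇒Col (rotate by′d)))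
                           (step x∈X a′∈X d∈X ¬xa′ ¬xd a′d
                             (step x∈X y∈X a′∈X ¬xy ¬xa′ (Col-sym (Line⇒Col (rotate (rotate yaa′)))) xy))
          where
          d∈X = proj₁ (proj₂ (proj₂ by′d))
          ¬xd : ¬ Col x d
          ¬xd xd = ¬xy′ (col-third (rotate (rotate by′d)) xd xb)
          ¬xa′ : ¬ Col x a′
          ¬xa′ xa′ = ¬xy (col-third (rotate yaa′) xa xa′)
          a′d : Col a′ d
          a′d with near by′d a′∈X
          ... | inj₁ a′b = ⊥-elim (¬ab (Col-sym (col-third (rotate (rotate yaa′)) (Col-sym a′b) (Line⇒Col (swap ybb′)))))
          ... | inj₂ (inj₁ a′y′) = ⊥-elim (¬yy′ (Col-sym (col-third (rotate yaa′) (inj₂ y′a) (Col-sym a′y′))))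
          ... | inj₂ (inj₂ c) = c

    spread : ∀ {x₀ y₀} → X x₀ → X y₀ → ¬ Col x₀ y₀ → F x₀ y₀ → ∀ {x y} → X x → X y → F x y
    spread {x₀} {y₀} x₀∈X y₀∈X ¬x₀y₀ x₀y₀ {x} {y} x∈X y∈X with Col? x y | Col? x₀ x | Col? x₀ y
    ... | yes xy | _ | _ = F-col x∈X y∈X xy
    ... | no ¬xy | no ¬x₀x | _ =
          fan x∈X x₀∈X y∈X (¬x₀x ∘ Col-sym) ¬xy
            (F-sym x₀∈X x∈X (fan x₀∈X y₀∈X x∈X ¬x₀y₀ ¬x₀x x₀y₀))
    ... | no ¬xy | yes _ | no ¬x₀y =
          F-sym y∈X x∈X (fan y∈X x₀∈X x∈X (¬x₀y ∘ Col-sym) (¬xy ∘ Col-sym)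
            (F-sym x₀∈X y∈X (fan x₀∈X y₀∈X y∈X ¬x₀y₀ ¬x₀y x₀y₀)))
    ... | no ¬xy | yes x₀x | yes (inj₁ refl) = ⊥-elim (¬xy (Col-sym x₀x))
    -- Here `x₀` is collinear with both `x` and `y`, so the relation must pass through a point `w`
    -- collinear with neither `x₀` nor `x`. One of `b`, `b′` serves: if `x` were collinear with
    -- both, it would be collinear with `y`.
    ... | no ¬xy | yes x₀x | yes (inj₂ x₀y) with avoidingLine y∈X x₀∈X x₀∈X (Adj-sym x₀y) (Adj-sym x₀y)
    ... | b , b′ , ybb′ , (¬bx₀ , ¬b′x₀) , _ = choose (Col? x b)
      where
      through : ∀ {w} → X w → ¬ Col w x₀ → ¬ Col x w → F x y
      through w∈X ¬wx₀ ¬xw = fan x∈X w∈X y∈X ¬xw ¬xy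
        (F-sym w∈X x∈X (fan w∈X x₀∈X x∈X ¬wx₀ (¬xw ∘ Col-sym)
          (F-sym x₀∈X w∈X (fan x₀∈X y₀∈X w∈X ¬x₀y₀ (¬wx₀ ∘ Col-sym) x₀y₀))))
      choose : Dec (Col x b) → F x y
      choose (no ¬xb) = through (proj₁ (proj₂ ybb′)) ¬bx₀ ¬xb
      choose (yes xb) = through (proj₁ (proj₂ (proj₂ ybb′))) ¬b′x₀
                          (λ xb′ → ¬xy (col-third (rotate ybb′) xb xb′))

-- The partitions T₁ and T₂

module Partitions (s : Setting) where
  open Setting s
  open Collinearity s

  quad₁ : ∀ i → IsQuad (λ x → t₁ x ≡ i)
  quad₁ i = proj₁ (T₁-quads i)

  quad₂ : ∀ j → IsQuad (λ x → t₂ x ≡ j)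
  quad₂ j = proj₁ (T₂-quads j)

  abstract
    -- Membership in a T₂-quad is tested by incidence with the line in which that quad meets the
    -- T₁-quad of `x`.
    t₂? : ∀ x j → Dec (t₂ x ≡ j)
    t₂? x j with T₁T₂-line (t₁ x) j
    ... | l , on = map′ (proj₂ ∘ proj₁ (on x)) (λ eq → proj₂ (on x) (refl , eq)) (inc? x l)

  sameClass⇒Col : ∀ {x y} → t₁ x ≡ t₁ y → t₂ x ≡ t₂ y → Col x y
  sameClass⇒Col {x} {y} e₁ e₂ with T₁T₂-line (t₁ y) (t₂ y)
  ... | l , on = onLine⇒Col (proj₂ (on x) (e₁ , e₂)) (proj₂ (on y) (refl , refl))

  abstract
    -- The quadrangle axiom is applied inside the T₂-quad of `x`, to the line it shares with the
    -- T₁-quad `i`; this is why the projection keeps `t₂`.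
    project₁ : ∀ x {i} → t₁ x ≢ i → Σ P λ y → t₁ y ≡ i × t₂ y ≡ t₂ x × Adj x y
    project₁ x {i} x∉i with T₁T₂-line i (t₂ x)
    ... | l , on with proj₂ (proj₂ (proj₂ (T₂-quads (t₂ x)))) x l refl
                        (λ z → proj₂ ∘ proj₁ (on z)) (x∉i ∘ proj₁ ∘ proj₁ (on x))
    ... | y , (y∈l , x≢y , k , _ , x∈k , y∈k) , _ =
          y , proj₁ (proj₁ (on y) y∈l) , proj₂ (proj₁ (on y) y∈l) , x≢y , k , x∈k , y∈k

    project₂ : ∀ x {j} → t₂ x ≢ j → Σ P λ y → t₂ y ≡ j × t₁ y ≡ t₁ x × Adj x y
    project₂ x {j} x∉j with T₁T₂-line (t₁ x) j
    ... | l , on with proj₂ (proj₂ (proj₂ (T₁-quads (t₁ x)))) x l refl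
                        (λ z → proj₁ ∘ proj₁ (on z)) (x∉j ∘ proj₂ ∘ proj₁ (on x))
    ... | y , (y∈l , x≢y , k , _ , x∈k , y∈k) , _ =
          y , proj₂ (proj₁ (on y) y∈l) , proj₁ (proj₁ (on y) y∈l) , x≢y , k , x∈k , y∈k

  -- The neighbour of x′ in its own T₂-quad is its only neighbour in the T₁-quad of x.
  crossing : ∀ {x x′} → Adj x x′ → t₁ x ≢ t₁ x′ → t₂ x ≡ t₂ x′
  crossing {x} {x′} xx′ t₁≢ with project₁ x′ {t₁ x} (≢-sym t₁≢)
  ... | y , e₁ , e₂ , x′y with uniqueNeighbour (quad₁ (t₁ x)) (≢-sym t₁≢) refl e₁ (Adj-sym xx′) x′y
  ... | refl = e₂

  -- Match x y: x projects onto y along the T₁-quad containing both.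
  Match : P → P → Set
  Match x y = t₁ x ≡ t₁ y × (x ≡ y ⊎ (t₂ x ≢ t₂ y × Adj x y))

  Match-sym : ∀ {x y} → Match x y → Match y x
  Match-sym (e , inj₁ x≡y) = sym e , inj₁ (sym x≡y)
  Match-sym (e , inj₂ (ne , xy)) = sym e , inj₂ (≢-sym ne , Adj-sym xy)

  abstract
    match : ∀ x j → Σ P λ y → t₂ y ≡ j × Match x y
    match x j with t₂? x j
    ... | yes e = x , e , refl , inj₁ refl
    ... | no ne with project₂ x ne
    ... | y , e₂ , e₁ , xy = y , e₂ , sym e₁ , inj₂ ((λ eq → ne (trans eq e₂)) , xy)

  Match⇒Proj : ∀ {x y j} → t₂ y ≡ j → Match x y → Proj (λ z → t₂ z ≡ j) x y
  Match⇒Proj e (_ , inj₁ refl) = inj₁ (e , refl)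
  Match⇒Proj e (_ , inj₂ (ne , xy)) = inj₂ ((λ eq → ne (trans eq (sym e))) , e , xy)

  -- In the main case let `w` be the match of `x′` and `y′` the projection of `y` to the T₁-quad of
  -- `x′`. If `w` and `y′` differed, both points `y`, `y′` of the line `m` would be at distance 2
  -- from `x′`, so some `o` on `m` would be nearer. As `o` lies in the T₂-quad of `y`, it would have
  -- to be `w`; then `m` would lie in the T₁-quad of `x′`, which misses `y`.
  square : ∀ {x y x′ y′} → Match x y → t₁ x ≢ t₁ x′ → Adj x x′ → Match x′ y′ → t₂ y ≡ t₂ y′ → Adj y y′
  square (_ , inj₁ refl) t₁≢ xx′ (_ , inj₁ refl) _ = xx′
  square (_ , inj₁ refl) t₁≢ xx′ (_ , inj₂ (ne , _)) e = ⊥-elim (ne (trans (sym (crossing xx′ t₁≢)) e))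
  square (_ , inj₂ (ne , _)) t₁≢ xx′ (_ , inj₁ refl) e = ⊥-elim (ne (trans (crossing xx′ t₁≢) (sym e)))
  square {x} {y} {x′} {w} (x₁y , inj₂ (x₂≢y , xy)) x₁≢x′ xx′ (x′₁w , inj₂ (x′₂≢w , x′w)) y₂w
    with project₁ y {t₁ x′} (λ e → x₁≢x′ (trans x₁y e))
  ... | y′ , y′₁ , y′₂ , yy′@(y≢y′ , m , y∈m , y′∈m) with w ≟P y′
  ... | yes refl = yy′
  ... | no w≢y′ = ⊥-elim (nearest (proj₁ (proj₂ isNearHexagon) x′ m))
    where
    x₂x′ = crossing xx′ x₁≢x′
    y₁≢x′ : t₁ y ≢ t₁ x′
    y₁≢x′ e = x₁≢x′ (trans x₁y e)
    x′₂≢y : t₂ x′ ≢ t₂ y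
    x′₂≢y e = x₂≢y (trans x₂x′ e)
    x′y2 : Dist x′ y 2
    x′y2 = dist2 (Adj-sym xx′) xy (λ e → y₁≢x′ (cong t₁ (sym e)))
             (λ x′y → x′₂≢y (crossing x′y (≢-sym y₁≢x′)))
    wy′ : Adj w y′
    wy′ = ≢⇒Adj w≢y′ (sameClass⇒Col (trans (sym x′₁w) (sym y′₁)) (trans (sym y₂w) (sym y′₂)))
    x′y′2 : Dist x′ y′ 2
    x′y′2 = dist2 x′w wy′ (λ e → x′₂≢y (trans (cong t₂ e) y′₂))
              (λ x′y′ → w≢y′ (uniqueNeighbour (quad₂ (t₂ y)) x′₂≢y (sym y₂w) y′₂ x′w x′y′))
    nearest : (Σ P λ o → Σ ℕ λ n → inc o m × Dist x′ o n ×
                (∀ z k → inc z m → z ≢ o → Dist x′ z k → n < k)) → ⊥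
    nearest (o , n , o∈m , x′o , farther) with o ≟P y
    ... | yes refl = proj₂ x′y2 n (farther y′ 2 y′∈m (≢-sym y≢y′) x′y′2) (proj₁ x′o)
    ... | no o≢y = close n (farther y 2 y∈m (≢-sym o≢y) x′y2) (proj₁ x′o)
      where
      o₂y : t₂ o ≡ t₂ y
      o₂y = proj₁ (quad₂ (t₂ y)) m y y′ o y≢y′ y∈m y′∈m refl y′₂ o∈m
      close : ∀ n → n < 2 → Walk n x′ o → ⊥
      close zero _ refl = x′₂≢y o₂y
      close (suc zero) _ (_ , x′o , refl)
        with uniqueNeighbour (quad₂ (t₂ y)) x′₂≢y (sym y₂w) o₂y x′w x′o
      ... | refl = y₁≢x′ (proj₁ (quad₁ (t₁ x′)) m w y′ y w≢y′ o∈m y′∈m (sym x′₁w) y′₁ y∈m)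
      close (suc (suc _)) (s≤s (s≤s ())) _

  abstract
    spreadPartner : ∀ w → Σ P λ u → t₁ u ≡ t₁ w × t₂ u ≡ t₂ w × Adj w u
    spreadPartner w with T₁T₂-line (t₁ w) (t₂ w)
    ... | l , on with proj₁ (proj₁ isNearHexagon) l
    ... | f , f-on , f-inj , _ = pick (w ≟P f zero)
      where
      Goal : Set
      Goal = Σ P λ u → t₁ u ≡ t₁ w × t₂ u ≡ t₂ w × Adj w u
      w∈l : inc w l
      w∈l = proj₂ (on w) (refl , refl)
      with-member : ∀ i → w ≢ f i → Goal
      with-member i w≢fi = f i , proj₁ (proj₁ (on _) (f-on i)) , proj₂ (proj₁ (on _) (f-on i)) , w≢fi , l , w∈l , f-on i
      pick : Dec (w ≡ f zero) → Goal
      pick (no w≢f0) = with-member zero w≢f0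
      pick (yes refl) = with-member (suc zero) (distinct ∘ f-inj _ _)
        where
        distinct : ¬ _≡_ {A = Fin 3} zero (suc zero)
        distinct ()

  -- The line joining `z` to `x` in Q̄ and `y` in Q is matched point by point into the T₂-quad of
  -- `z′`. By `square` the images are pairwise collinear, hence on one line by `noTriangles`.
  Q̿-match : ∀ {z z′} → Q̿ z → t₁ z ≡ t₁ z′ → t₂ z ≢ t₂ z′ → Adj z z′ → Q̿ z′
  Q̿-match (x , x∈Q̄ , x∉Q , y , inj₁ (x∈Q , _) , _) = ⊥-elim (x∉Q x∈Q)
  Q̿-match {z} {z′} (x , x∈Q̄ , x∉Q , y , inj₂ (_ , y∈Q , xy) , z≢x , z≢y , l , x∈l , y∈l , z∈l) z₁z′ z₂≢z′ zz′
    with match x (t₂ z′) | match y (t₂ z′)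
  ... | x′ , x′₂ , mx | y′ , y′₂ , my = x′ , trans (sym (proj₁ mx)) x∈Q̄ , x′∉Q , y′
        , inj₂ (x′∉Q , trans (sym (proj₁ my)) y∈Q , x′y′)
        , proj₁ (Adj-sym x′z′) , proj₁ (Adj-sym y′z′)
        , k , x′∈k , y′∈k , noTriangles x′≢y′ x′∈k y′∈k (inj₂ (Adj-sym x′z′)) (inj₂ (Adj-sym y′z′))
    where
    mz : Match z z′
    mz = z₁z′ , inj₂ (z₂≢z′ , zz′)
    x₁≢y : t₁ x ≢ t₁ y
    x₁≢y e = x∉Q (trans e y∈Q)
    x₁≢z : t₁ x ≢ t₁ z
    x₁≢z e = x₁≢y (sym (proj₁ (quad₁ (t₁ x)) l x z y (≢-sym z≢x) x∈l z∈l refl (sym e) y∈l))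
    y₁≢z : t₁ y ≢ t₁ z
    y₁≢z e = x₁≢y (proj₁ (quad₁ (t₁ y)) l y z x (≢-sym z≢y) y∈l z∈l refl (sym e) x∈l)
    x′∉Q : ¬ Q x′
    x′∉Q x′∈Q = x∉Q (trans (proj₁ mx) x′∈Q)
    x′y′ : Adj x′ y′
    x′y′ = square mx x₁≢y xy my (trans x′₂ (sym y′₂))
    x′z′ : Adj x′ z′
    x′z′ = square mx x₁≢z (≢-sym z≢x , l , x∈l , z∈l) mz x′₂
    y′z′ : Adj y′ z′
    y′z′ = square my y₁≢z (≢-sym z≢y , l , y∈l , z∈l) mz y′₂
    x′≢y′ = proj₁ x′y′
    k = proj₁ (proj₂ x′y′)
    x′∈k = proj₁ (proj₂ (proj₂ x′y′))
    y′∈k = proj₂ (proj₂ (proj₂ x′y′))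

  -- Within one line of the spread, walk z ~ w ~ v ~ z′ leaving the T₂-quad at each step.
  Q̿-spreadLine : ∀ {z z′} → Q̿ z → z ≢ z′ → t₁ z ≡ t₁ z′ → t₂ z ≡ t₂ z′ → Q̿ z′
  Q̿-spreadLine {z} {z′} z∈Q̿ z≢z′ z₁z′ z₂z′ = first (avoidingLine refl (sym z₁z′) (sym z₁z′) zz′ zz′)
    where
    open Quadrangle s (λ x → t₁ x ≡ t₁ z) (T₁-quads (t₁ z))
    zz′ : Adj z z′
    zz′ = ≢⇒Adj z≢z′ (sameClass⇒Col z₁z′ z₂z′)
    first : (Σ P λ w → Σ P λ w′ → Line z w w′ × (¬ Col w z′ × ¬ Col w′ z′) × (¬ Col w z′ × ¬ Col w′ z′)) → Q̿ z′
    first (w , _ , zw@(_ , w₁ , _) , (¬wz′ , _) , _) with spreadPartner w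
    -- `u` is a second point on the spread line of `w`. On a line through `w` avoiding `z` and `u`,
    -- the next point `v` lies neither in the T₂-quad of `w` nor in that of `z′`.
    ... | u , u₁ , u₂ , wu = second (avoidingLine w₁ refl (trans u₁ w₁) (Adj-sym (Line⇒Adj zw)) wu)
      where
      z₂≢w : t₂ z ≢ t₂ w
      z₂≢w e = ¬wz′ (sameClass⇒Col (trans w₁ z₁z′) (trans (sym e) z₂z′))
      w∈Q̿ : Q̿ w
      w∈Q̿ = Q̿-match z∈Q̿ (sym w₁) z₂≢w (Line⇒Adj zw)
      last : ∀ {v} → t₁ v ≡ t₁ z → Adj w v → ¬ Col v z → ¬ Col v u → Col z′ v → Q̿ z′
      last v₁ wv ¬vz ¬vu (inj₁ refl) = ⊥-elim (¬vz (inj₂ (Adj-sym zz′)))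
      last v₁ wv ¬vz ¬vu (inj₂ z′v) =
        Q̿-match (Q̿-match w∈Q̿ (trans w₁ (sym v₁))
                  (λ e → ¬vu (sameClass⇒Col (trans v₁ (sym (trans u₁ w₁))) (trans (sym e) (sym u₂)))) wv)
          (trans v₁ z₁z′) (λ e → ¬vz (sameClass⇒Col v₁ (trans e (sym z₂z′)))) (Adj-sym z′v)
      second : (Σ P λ b → Σ P λ b′ → Line w b b′ × (¬ Col b z × ¬ Col b′ z) × (¬ Col b u × ¬ Col b′ u)) → Q̿ z′
      second (b , b′ , wbb′@(_ , b₁ , b′₁ , _) , (¬bz , ¬b′z) , (¬bu , ¬b′u)) with near wbb′ (sym z₁z′)
      ... | inj₁ z′w = ⊥-elim (¬wz′ (Col-sym z′w))
      ... | inj₂ (inj₁ z′b) = last b₁ (Line⇒Adj wbb′) ¬bz ¬bu z′b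
      ... | inj₂ (inj₂ z′b′) = last b′₁ (Adj-sym (Line⇒Adj (rotate (rotate wbb′)))) ¬b′z ¬b′u z′b′

  -- Q̿ is defined point by point through reflections; this shows that it is a union of T₁-quads.
  -- First `z` is projected into the T₂-quad of `z′`, then moved along the spread line.
  Q̿-class : ∀ {z z′} → Q̿ z → t₁ z ≡ t₁ z′ → Q̿ z′
  Q̿-class {z} {z′} z∈Q̿ z₁z′ = along (t₂? z (t₂ z′))
    where
    inSpreadLine : ∀ {y} → Q̿ y → t₁ y ≡ t₁ z′ → t₂ y ≡ t₂ z′ → Q̿ z′
    inSpreadLine {y} y∈Q̿ e₁ e₂ with y ≟P z′
    ... | yes refl = y∈Q̿
    ... | no y≢z′ = Q̿-spreadLine y∈Q̿ y≢z′ e₁ e₂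
    along : Dec (t₂ z ≡ t₂ z′) → Q̿ z′
    along (yes e) = inSpreadLine z∈Q̿ z₁z′ e
    along (no ne) with project₂ z ne
    ... | y , y₂ , y₁ , zy =
          inSpreadLine (Q̿-match z∈Q̿ (sym y₁) (λ e → ne (trans e y₂)) zy) (trans y₁ z₁z′) y₂

  -- `Q̿-class` turns the single point of Q₁ outside Q̿ into disjointness of the two.
  Q₁∩Q̿ : ∀ {z} → t₁ z ≡ iQ₁ → ¬ Q̿ z
  Q₁∩Q̿ z₁ z∈Q̿ = proj₂ (proj₂ iQ₁≢Q̿) (Q̿-class z∈Q̿ (trans z₁ (sym (proj₁ (proj₂ iQ₁≢Q̿)))))

-- The subquadrangles Wⁱ and the map ε

module Subquadrangles (s : Setting) where
  open Setting s
  open Collinearity s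
  open Partitions s

  -- Take a line of `X` through `q`. If `p` is off it, the quadrangle axiom joins `p` within `X` to
  -- one of its points, and that point must be `q`, since otherwise a triangle arises.
  gq⇒subspace : ∀ {X} → IsGQ 2 2 X → ∀ {p q} → X p → X q → Adj p q → AdjIn X p q
  gq⇒subspace {X} (_ , lines , axiom) {p} {q} p∈X q∈X pq@(p≢q , k , p∈k , q∈k) with lines q q∈X
  ... | f , f-on , _ = cases (inc? p (f zero))
    where
    l = f zero
    q∈l = proj₁ (f-on zero)
    cases : Dec (inc p l) → AdjIn X p q
    cases (yes p∈l) = p≢q , l , proj₂ (f-on zero) , p∈l , q∈l
    cases (no p∉l) with axiom p l p∈X (proj₂ (f-on zero)) p∉l
    ... | y , (y∈l , p∼y@(p≢y , m , _ , p∈m , y∈m)) , _ with y ≟P q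
    ... | yes refl = p∼y
    ... | no y≢q = ⊥-elim (p∉l (noTriangles y≢q y∈l q∈l (inj₂ (p≢y , m , p∈m , y∈m)) (inj₂ pq)))

  -- Otherwise Wⁱ contains M*.  A point m of M* is collinear in Wⁱ with one point of each
  -- transversal of the grid, and these three points are pairwise non-collinear, so
  -- together with M* there would be four lines of Wⁱ through m.
  M*∩W-atMostOne : ∀ {i m m′} → M* m → M* m′ → W i m → W i m′ → m ≡ m′
  M*∩W-atMostOne {i} {m} {m′} (m₂ , m₁) (m′₂ , m′₁) m∈W m′∈W with m ≟P m′
  ... | yes m≡m′ = m≡m′
  ... | no m≢m′ = ⊥-elim (fourthLine (proj₁ (proj₂ gq) m m∈W))
    where
    gq : IsGQ 2 2 (W i)
    gq = proj₁ (proj₂ (W-sub i))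
    grid⊆W : ∀ x → Grid x → W i x
    grid⊆W = proj₂ (proj₂ (W-sub i))
    m∉Q : t₁ m ≢ iQ
    m∉Q e = iQ₁≢iQ (trans (sym m₁) e)
    m∉Q̄ : t₁ m ≢ iQ̄
    m∉Q̄ e = iQ₁≢iQ̄ (trans (sym m₁) e)
    Q∩Q̄ : ∀ {x} → t₁ x ≡ iQ → t₁ x ≢ iQ̄
    Q∩Q̄ e e′ = iQ≢iQ̄ (trans (sym e) e′)

    mm′ : AdjIn (W i) m m′
    mm′ = gq⇒subspace gq m∈W m′∈W (≢⇒Adj m≢m′ (sameClass⇒Col (trans m₁ (sym m′₁)) (trans m₂ (sym m′₂))))
    M-line = proj₁ (proj₂ mm′)
    M⊆Q₁ : ∀ z → inc z M-line → t₁ z ≡ iQ₁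
    M⊆Q₁ z = proj₁ (quad₁ iQ₁) M-line m m′ z m≢m′ (proj₁ (proj₂ (proj₂ (proj₂ mm′)))) (proj₂ (proj₂ (proj₂ (proj₂ mm′)))) m₁ m′₁

    fourthLine : CountP (λ l → inc m l × LineIn (W i) l) 3 → ⊥
    fourthLine (f , f-on , f-inj , f-onto) with project₁ m m∉Q | project₁ m m∉Q̄
    ... | x₀ , x₀₁ , x₀₂ , mx₀ | y₁ , y₁₁ , y₁₂ , my₁ with project₁ y₁ {iQ} (λ e → Q∩Q̄ e y₁₁)
    ... | x₁ , x₁₁ , x₁₂ , y₁x₁ = withThird (third x₀₁ x₁₁ x₀x₁)
      where
      open Quadrangle s Q (T₁-quads iQ)
      y₁∉Q : ¬ Q y₁
      y₁∉Q e = Q∩Q̄ e y₁₁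
      -- Otherwise `m` would be the reflection of `y₁` in Q, hence a point of Q̿.
      ¬y₁x₀ : ¬ Adj y₁ x₀
      ¬y₁x₀ y₁x₀@(y₁≢x₀ , l , y₁∈l , x₀∈l) =
        Q₁∩Q̿ m₁ (y₁ , y₁₁ , y₁∉Q , x₀ , inj₂ (y₁∉Q , x₀₁ , y₁x₀) , proj₁ my₁ , proj₁ mx₀ , l , y₁∈l , x₀∈l ,
                 noTriangles y₁≢x₀ y₁∈l x₀∈l (inj₂ my₁) (inj₂ mx₀))
      x₀x₁ : Adj x₀ x₁
      x₀x₁ = ≢⇒Adj (λ { refl → ¬y₁x₀ y₁x₁ }) (sameClass⇒Col (trans x₀₁ (sym x₁₁)) (trans x₀₂ (sym (trans x₁₂ y₁₂))))
      withThird : ∃ (Line x₀ x₁) → ⊥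
      withThird (x₂ , (_ , _ , x₂₁ , x₀≢x₁ , x₁≢x₂ , x₀≢x₂ , k , x₀∈k , x₁∈k , x₂∈k))
        with project₁ x₂ {iQ̄} (Q∩Q̄ x₂₁)
      ... | y₂ , y₂₁ , y₂₂ , x₂y₂@(x₂≢y₂ , l , x₂∈l , y₂∈l) with thirdPoint x₂≢y₂ x₂∈l y₂∈l
      ... | z₂ , z₂∈l , z₂≢x₂ , z₂≢y₂ , l-members = fourLines
            (throughM x₀∈W mx₀) (throughM y₁∈W my₁) mz₂
        where
        x₂₂ : t₂ x₂ ≡ j*
        x₂₂ = proj₁ (quad₂ j*) k x₀ x₁ x₂ x₀≢x₁ x₀∈k x₁∈k (trans x₀₂ m₂) (trans x₁₂ (trans y₁₂ m₂)) x₂∈k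
        z₂₂ : t₂ z₂ ≡ j*
        z₂₂ = proj₁ (quad₂ j*) l x₂ y₂ z₂ x₂≢y₂ x₂∈l y₂∈l x₂₂ (trans y₂₂ x₂₂) z₂∈l
        y₂∉Q : ¬ Q y₂
        y₂∉Q e = Q∩Q̄ e y₂₁
        z₂∈Q̿ : Q̿ z₂
        z₂∈Q̿ = y₂ , y₂₁ , y₂∉Q , x₂ , inj₂ (y₂∉Q , x₂₁ , Adj-sym x₂y₂) , z₂≢y₂ , z₂≢x₂ , l , y₂∈l , x₂∈l , z₂∈l
        z₂∉Q : ¬ Q z₂
        z₂∉Q e = y₂∉Q (proj₁ (quad₁ iQ) l x₂ z₂ y₂ (≢-sym z₂≢x₂) x₂∈l z₂∈l x₂₁ e y₂∈l)
        z₂∉Q̄ : ¬ Q̄ z₂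
        z₂∉Q̄ e = Q∩Q̄ x₂₁ (proj₁ (quad₁ iQ̄) l y₂ z₂ x₂ (≢-sym z₂≢y₂) y₂∈l z₂∈l y₂₁ e x₂∈l)
        x₀∈W = grid⊆W x₀ (trans x₀₂ m₂ , inj₁ x₀₁)
        y₁∈W = grid⊆W y₁ (trans y₁₂ m₂ , inj₂ (inj₁ y₁₁))
        y₁≢y₂ : y₁ ≢ y₂
        y₁≢y₂ refl = x₁≢x₂ (uniqueNeighbour (quad₁ iQ) y₁∉Q x₁₁ x₂₁ y₁x₁ (Adj-sym x₂y₂))

        l⊆W : LineIn (W i) l
        l⊆W w w∈l with l-members w w∈l
        ... | inj₁ refl = grid⊆W x₂ (x₂₂ , inj₁ x₂₁)
        ... | inj₂ (inj₁ refl) = grid⊆W y₂ (trans y₂₂ x₂₂ , inj₂ (inj₁ y₂₁))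
        ... | inj₂ (inj₂ refl) = grid⊆W z₂ (z₂₂ , inj₂ (inj₂ z₂∈Q̿))
        m∉l : ¬ inc m l
        m∉l m∈l with l-members m m∈l
        ... | inj₁ refl = m∉Q x₂₁
        ... | inj₂ (inj₁ refl) = m∉Q̄ y₂₁
        ... | inj₂ (inj₂ refl) = Q₁∩Q̿ m₁ z₂∈Q̿

        ThroughM : P → Set
        ThroughM x = Σ (Fin 3) λ a → inc x (f a)
        fromAdjIn : ∀ {x} → AdjIn (W i) m x → ThroughM x
        fromAdjIn (_ , h , h⊆W , m∈h , x∈h) with f-onto h (m∈h , h⊆W)
        ... | a , refl = a , x∈h
        throughM : ∀ {x} → W i x → Adj m x → ThroughM x
        throughM x∈W mx = fromAdjIn (gq⇒subspace gq m∈W x∈W mx)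
        -- The quadrangle axiom in Wⁱ joins `m` to a point of the transversal `x₂ y₂ z₂`. Since `m`
        -- already has the neighbours `x₀` in Q and `y₁` in Q̄, only `z₂` is left.
        mz₂ : ThroughM z₂
        mz₂ with proj₂ (proj₂ gq) m l m∈W l⊆W m∉l
        ... | w , (w∈l , m∼w@(m≢w , h , _ , m∈h , w∈h)) , _ with l-members w w∈l
        ... | inj₁ refl = ⊥-elim (x₀≢x₂ (uniqueNeighbour (quad₁ iQ) m∉Q x₀₁ x₂₁ mx₀ (m≢w , h , m∈h , w∈h)))
        ... | inj₂ (inj₁ refl) = ⊥-elim (y₁≢y₂ (uniqueNeighbour (quad₁ iQ̄) m∉Q̄ y₁₁ y₂₁ my₁ (m≢w , h , m∈h , w∈h)))
        ... | inj₂ (inj₂ refl) = fromAdjIn m∼w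

        -- Any coincidence among the four lines makes `x₀` and `y₁` collinear, or gives `z₂` two
        -- neighbours in Q or in Q̄, or puts a grid point in Q₁.
        fourLines : ThroughM x₀ → ThroughM y₁ → ThroughM z₂ → ⊥
        fourLines (a , x₀∈a) (b , y₁∈b) (c , z₂∈c)
          with f-onto M-line (proj₁ (proj₂ (proj₂ (proj₂ mm′))) , proj₁ (proj₂ (proj₂ mm′)))
        ... | d , fd≡M with fourInThree a b c d
        ... | inj₁ refl = ¬y₁x₀ ((λ { refl → y₁∉Q x₀₁ }) , f a , y₁∈b , x₀∈a)
        ... | inj₂ (inj₁ refl) = x₀≢x₂ (uniqueNeighbour (quad₁ iQ) z₂∉Q x₀₁ x₂₁
                (≢⇒Adj (λ { refl → z₂∉Q x₀₁ }) (onLine⇒Col z₂∈c x₀∈a)) (z₂≢x₂ , l , z₂∈l , x₂∈l))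
        ... | inj₂ (inj₂ (inj₁ refl)) = iQ₁≢iQ (trans (sym (M⊆Q₁ x₀ (subst (inc x₀) fd≡M x₀∈a))) x₀₁)
        ... | inj₂ (inj₂ (inj₂ (inj₁ refl))) = y₁≢y₂ (uniqueNeighbour (quad₁ iQ̄) z₂∉Q̄ y₁₁ y₂₁
                (≢⇒Adj (λ { refl → z₂∉Q̄ y₁₁ }) (onLine⇒Col z₂∈c y₁∈b)) (z₂≢y₂ , l , z₂∈l , y₂∈l))
        ... | inj₂ (inj₂ (inj₂ (inj₂ (inj₁ refl)))) = iQ₁≢iQ̄ (trans (sym (M⊆Q₁ y₁ (subst (inc y₁) fd≡M y₁∈b))) y₁₁)
        ... | inj₂ (inj₂ (inj₂ (inj₂ (inj₂ refl)))) = Q₁∩Q̿ (M⊆Q₁ z₂ (subst (inc z₂) fd≡M z₂∈c)) z₂∈Q̿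

  abstract
    project-M* : ∀ x → L* x → Σ P λ m → M* m × Adj x m
    project-M* x (x₁ , x₂) with project₁ x {iQ₁} (λ e → iQ₁≢iQ (trans (sym e) x₁))
    ... | m , m₁ , m₂ , xm = m , (trans m₂ x₂ , m₁) , xm

  -- Equal values place the neighbours of `x` and `y` in `M*` in the same Wⁱ, so they coincide, and
  -- that point has only one neighbour in Q.
  ε-L*-injective : ∀ x y → L* x → L* y → εQ x ≡ εQ y → x ≡ y
  ε-L*-injective x y x∈L* y∈L* e with project-M* x x∈L* | project-M* y y∈L*
  ... | m , m∈M* , xm | m′ , m′∈M* , ym′
    with M*∩W-atMostOne m∈M* m′∈M* (ε-L* x m x∈L* m∈M* xm)
           (subst (λ i → W i m′) (sym e) (ε-L* y m′ y∈L* m′∈M* ym′))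
  ... | refl = uniqueNeighbour (quad₁ iQ) (λ m∈Q → iQ₁≢iQ (trans (sym (proj₂ m∈M*)) m∈Q))
                 (proj₁ x∈L*) (proj₁ y∈L*) (Adj-sym xm) (Adj-sym ym′)

  abstract
    ε-L*-surjective : ∀ i → Σ P λ x → L* x × εQ x ≡ i
    ε-L*-surjective i with T₁T₂-line iQ j*
    ... | l , on with proj₁ (proj₁ isNearHexagon) l
    ... | f , f-on , f-inj , _
      with injective⇒surjective (εQ ∘ f) (λ a b e → f-inj a b
             (ε-L*-injective _ _ (proj₁ (on _) (f-on a)) (proj₁ (on _) (f-on b)) e)) i
    ... | a , e = f a , proj₁ (on _) (f-on a) , e

    -- Each index `k` is attained by ε on `L*`, so a point of `M*` in `W k` is the neighbour of a
    -- point of `L*` with value `k`; that point is determined by `m`.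
    M*∩W-unique : ∀ {i j m} → M* m → W i m → W j m → i ≡ j
    M*∩W-unique {i} {j} {m} m∈M* m∈Wi m∈Wj with neighbour i m∈Wi | neighbour j m∈Wj
      where
      neighbour : ∀ k → W k m → Σ P λ y → Q y × Adj m y × εQ y ≡ k
      neighbour k m∈Wk with ε-L*-surjective k
      ... | y , y∈L* , refl with project-M* y y∈L*
      ... | m′ , m′∈M* , ym′ with M*∩W-atMostOne m∈M* m′∈M* m∈Wk (ε-L* y m′ y∈L* m′∈M* ym′)
      ... | refl = y , proj₁ y∈L* , Adj-sym ym′ , refl
    ... | y , y∈Q , my , refl | y′ , y′∈Q , my′ , refl =
          cong εQ (uniqueNeighbour (quad₁ iQ) (λ m∈Q → iQ₁≢iQ (trans (sym (proj₂ m∈M*)) m∈Q)) y∈Q y′∈Q my my′)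

  ε-match : ∀ {x y} → Q y → t₂ x ≡ j* → Match x y → εQ y ≡ εQ x
  ε-match y₁ x₂ (_ , inj₁ refl) = refl
  ε-match y₁ x₂ (e , inj₂ (ne , xy)) =
    ε-Q _ _ (trans e y₁ , x₂) y₁ (λ y∈L* → ne (trans x₂ (sym (proj₂ y∈L*)))) xy

  abstract
    ε-spread-surjective : ∀ j i → Σ P λ u → Q u × t₂ u ≡ j × εQ u ≡ i
    ε-spread-surjective j i with ε-L*-surjective i
    ... | x , (x₁ , x₂) , e with match x j
    ... | u , u₂ , xu = u , u∈Q , u₂ , trans (ε-match u∈Q x₂ xu) e
      where
      u∈Q : Q u
      u∈Q = trans (sym (proj₁ xu)) x₁

  -- The neighbours in Q₁ of x, p, q and y (x, y the projections of p, q on L*) are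
  -- successive images under the three projections that define θ.
  ε-shift : ∀ {p q} → Q p → Q q → Adj p q → t₂ p ≢ t₂ q → εQ q ≡ εQ p ⊕ θ (t₂ p) (t₂ q)
  ε-shift {p} {q} p₁ q₁ pq p₂≢q₂ with match p j* | match q j*
  ... | x , x₂ , px | y , y₂ , qy with project-M* x (trans (sym (proj₁ px)) p₁ , x₂)
  ... | m , m∈M* , xm with match m (t₂ p)
  ... | m₁ , m₁₂ , mm₁ with match m₁ (t₂ q)
  ... | m₂ , m₂₂ , m₁m₂ with match m₂ j*
  ... | m₃ , m₃₂ , m₂m₃ = trans (ε-match q₁ y₂ (Match-sym qy)) (trans ε-y (cong (_⊕ θ (t₂ p) (t₂ q)) (sym ε-p)))
    where
    x₁ : Q x
    x₁ = trans (sym (proj₁ px)) p₁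
    y₁ : Q y
    y₁ = trans (sym (proj₁ qy)) q₁
    m₁∈Q₁ : t₁ m₁ ≡ iQ₁
    m₁∈Q₁ = trans (sym (proj₁ mm₁)) (proj₂ m∈M*)
    m₂∈Q₁ : t₁ m₂ ≡ iQ₁
    m₂∈Q₁ = trans (sym (proj₁ m₁m₂)) m₁∈Q₁
    m₃∈Q₁ : t₁ m₃ ≡ iQ₁
    m₃∈Q₁ = trans (sym (proj₁ m₂m₃)) m₂∈Q₁
    apart : ∀ {a b} → Q a → t₁ b ≡ iQ₁ → t₁ a ≢ t₁ b
    apart a₁ b₁ e = iQ₁≢iQ (trans (sym b₁) (trans (sym e) a₁))
    pm₁ : Adj p m₁
    pm₁ = square (Match-sym px) (apart x₁ (proj₂ m∈M*)) xm mm₁ (sym m₁₂)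
    qm₂ : Adj q m₂
    qm₂ = square (trans p₁ (sym q₁) , inj₂ (p₂≢q₂ , pq)) (apart p₁ m₁∈Q₁) pm₁ m₁m₂ (sym m₂₂)
    ym₃ : Adj y m₃
    ym₃ = square qy (apart q₁ m₂∈Q₁) qm₂ m₂m₃ (trans y₂ (sym m₃₂))
    ε-p : εQ p ≡ εQ x
    ε-p = ε-match p₁ x₂ (Match-sym px)
    m₃∈W : W (εQ x ⊕ θ (t₂ p) (t₂ q)) m₃
    m₃∈W = proj₁ (θ-def (t₂ p) (t₂ q) (εQ x) m₃)
      (m , m₁ , m₂ , ε-L* x m (x₁ , x₂) m∈M* xm , Match⇒Proj m₁₂ mm₁ , Match⇒Proj m₂₂ m₁m₂ , Match⇒Proj m₃₂ m₂m₃)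
    ε-y : εQ y ≡ εQ x ⊕ θ (t₂ p) (t₂ q)
    ε-y = M*∩W-unique (m₃₂ , m₃∈Q₁) (ε-L* y m₃ (y₁ , y₂) (m₃₂ , m₃∈Q₁) ym₃) m₃∈W

-- Commuting elements of a group

module Commuting (G : Group 0ℓ 0ℓ) where
  open Group G renaming (refl to ≈-refl; sym to ≈-sym; trans to ≈-trans)
  open GroupTheory G
  open GroupProperties G
  open SetoidReasoning setoid

  Comm : Carrier → Carrier → Set
  Comm a b = a ∙ b ≈ b ∙ a

  comm-respʳ : ∀ {a b c} → b ≈ c → Comm a b → Comm a c
  comm-respʳ b≈c ab = ≈-trans (∙-congˡ (≈-sym b≈c)) (≈-trans ab (∙-congʳ b≈c))

  comm-∙ : ∀ {a b c} → Comm a b → Comm a c → Comm a (b ∙ c)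
  comm-∙ {a} {b} {c} ab ac = begin
    a ∙ (b ∙ c)  ≈⟨ assoc a b c ⟨
    (a ∙ b) ∙ c  ≈⟨ ∙-congʳ ab ⟩
    (b ∙ a) ∙ c  ≈⟨ assoc b a c ⟩
    b ∙ (a ∙ c)  ≈⟨ ∙-congˡ ac ⟩
    b ∙ (c ∙ a)  ≈⟨ assoc b c a ⟨
    (b ∙ c) ∙ a  ∎

  comm-⁻¹ : ∀ {a b} → Comm a b → Comm a (b ⁻¹)
  comm-⁻¹ {a} {b} ab = ∙-cancelˡ b _ _ (begin
    b ∙ (a ∙ b ⁻¹)    ≈⟨ assoc b a (b ⁻¹) ⟨
    (b ∙ a) ∙ b ⁻¹    ≈⟨ ∙-congʳ ab ⟨
    (a ∙ b) ∙ b ⁻¹    ≈⟨ assoc a b (b ⁻¹) ⟩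
    a ∙ (b ∙ b ⁻¹)    ≈⟨ ∙-congˡ (inverseʳ b) ⟩
    a ∙ ε             ≈⟨ identityʳ a ⟩
    a                 ≈⟨ identityˡ a ⟨
    ε ∙ a             ≈⟨ ∙-congʳ (inverseʳ b) ⟨
    (b ∙ b ⁻¹) ∙ a    ≈⟨ assoc b (b ⁻¹) a ⟩
    b ∙ (b ⁻¹ ∙ a)    ∎)

  comm-gen : ∀ {X a b} → (∀ {x} → X x → Comm a x) → Gen X b → Comm a b
  comm-gen aX (gen x∈X) = aX x∈X
  comm-gen {a = a} aX one = ≈-trans (identityʳ a) (≈-sym (identityˡ a))
  comm-gen aX (mul p q) = comm-∙ (comm-gen aX p) (comm-gen aX q)
  comm-gen aX (inv p) = comm-⁻¹ (comm-gen aX p)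
  comm-gen aX (resp x≈y p) = comm-respʳ x≈y (comm-gen aX p)

  gen-abelian : ∀ {X a b} → (∀ {x y} → X x → X y → Comm x y) → Gen X a → Gen X b → Comm a b
  gen-abelian XX a∈ b∈ = comm-gen (λ y∈X → ≈-sym (comm-gen (λ x∈X → XX y∈X x∈X) a∈)) b∈

  gen-mono : ∀ {X Y} → (∀ {x} → X x → Gen Y x) → ∀ {a} → Gen X a → Gen Y a
  gen-mono XY (gen x∈X) = XY x∈X
  gen-mono XY one = one
  gen-mono XY (mul p q) = mul (gen-mono XY p) (gen-mono XY q)
  gen-mono XY (inv p) = inv (gen-mono XY p)
  gen-mono XY (resp x≈y p) = resp x≈y (gen-mono XY p)

  -- The corner `z` of the grid is read off in two ways, as `(ax)(yb)` and as `(ay)(xb)`; cancelling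
  -- `a` and `b` leaves `xy = yx`.
  grid⇒comm : ∀ {a x p y b q r t z} → a ∙ x ≈ p → y ∙ b ≈ q → r ∙ t ≈ z →
              a ∙ y ≈ r → x ∙ b ≈ t → p ∙ q ≈ z → Comm x y
  grid⇒comm {a} {x} {p} {y} {b} {q} {r} {t} {z} ax yb rt ay xb pq =
    ∙-cancelˡ a _ _ (∙-cancelʳ b _ _ (begin
      (a ∙ (x ∙ y)) ∙ b    ≈⟨ solve monoid ⟩
      (a ∙ x) ∙ (y ∙ b)    ≈⟨ ∙-cong ax yb ⟩
      p ∙ q                ≈⟨ pq ⟩
      z                    ≈⟨ rt ⟨
      r ∙ t                ≈⟨ ∙-cong ay xb ⟨
      (a ∙ y) ∙ (x ∙ b)    ≈⟨ solve monoid ⟩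
      (a ∙ (y ∙ x)) ∙ b    ∎))

  -- The shape of a product of two values of ψ at points of type (P4): only moving `x′` past `y`
  -- costs the central factor `z`, which is λ on lines of type (L9).
  interchange : ∀ {x x′ y y′ d e z} → (∀ w → Comm z w) → x′ ∙ y ≈ (y ∙ x′) ∙ z → Comm d (y ∙ y′) →
                ((x ∙ x′) ∙ d) ∙ ((y ∙ y′) ∙ e) ≈ ((x ∙ y) ∙ (x′ ∙ y′)) ∙ ((d ∙ e) ∙ z)
  interchange {x} {x′} {y} {y′} {d} {e} {z} central twist dy = begin
    ((x ∙ x′) ∙ d) ∙ ((y ∙ y′) ∙ e)            ≈⟨ solve monoid ⟩
    (x ∙ x′) ∙ ((d ∙ (y ∙ y′)) ∙ e)            ≈⟨ ∙-congˡ (∙-congʳ dy) ⟩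
    (x ∙ x′) ∙ (((y ∙ y′) ∙ d) ∙ e)            ≈⟨ solve monoid ⟩
    x ∙ ((x′ ∙ y) ∙ ((y′ ∙ d) ∙ e))            ≈⟨ ∙-congˡ (∙-congʳ twist) ⟩
    x ∙ (((y ∙ x′) ∙ z) ∙ ((y′ ∙ d) ∙ e))      ≈⟨ solve monoid ⟩
    ((x ∙ y) ∙ x′) ∙ (z ∙ ((y′ ∙ d) ∙ e))      ≈⟨ ∙-congˡ (central _) ⟩
    ((x ∙ y) ∙ x′) ∙ (((y′ ∙ d) ∙ e) ∙ z)      ≈⟨ solve monoid ⟩
    ((x ∙ y) ∙ (x′ ∙ y′)) ∙ ((d ∙ e) ∙ z)      ∎

  interchange-comm : ∀ {x x′ y y′ d e} → Comm x′ y → Comm d (y ∙ y′) →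
                     ((x ∙ x′) ∙ d) ∙ ((y ∙ y′) ∙ e) ≈ ((x ∙ y) ∙ (x′ ∙ y′)) ∙ (d ∙ e)
  interchange-comm x′y dy = ≈-trans
    (interchange (λ w → ≈-trans (identityˡ w) (≈-sym (identityʳ w))) (≈-trans x′y (≈-sym (identityʳ _))) dy)
    (∙-congˡ (identityʳ _))

  assoc-into : ∀ a b c d → a ∙ ((b ∙ c) ∙ d) ≈ ((a ∙ b) ∙ c) ∙ d
  assoc-into a b c d = solve monoid

  interchange-left : ∀ {x x′ y y′ d} → Comm x′ y →
                     (x ∙ x′) ∙ ((y ∙ y′) ∙ d) ≈ ((x ∙ y) ∙ (x′ ∙ y′)) ∙ d
  interchange-left {x} {x′} {y} {y′} {d} x′y = begin
    (x ∙ x′) ∙ ((y ∙ y′) ∙ d)      ≈⟨ solve monoid ⟩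
    x ∙ ((x′ ∙ y) ∙ (y′ ∙ d))      ≈⟨ ∙-congˡ (∙-congʳ x′y) ⟩
    x ∙ ((y ∙ x′) ∙ (y′ ∙ d))      ≈⟨ solve monoid ⟩
    ((x ∙ y) ∙ (x′ ∙ y′)) ∙ d      ∎

  commutator : ∀ a b → (b ∙ a) ∙ [ a , b ] ≈ a ∙ b
  commutator a b = begin
    (b ∙ a) ∙ (((a ⁻¹ ∙ b ⁻¹) ∙ a) ∙ b)    ≈⟨ ∙-congˡ (∙-congʳ (∙-congʳ (⁻¹-anti-homo-∙ b a))) ⟨
    (b ∙ a) ∙ ((((b ∙ a) ⁻¹) ∙ a) ∙ b)     ≈⟨ ∙-congˡ (assoc _ a b) ⟩
    (b ∙ a) ∙ ((b ∙ a) ⁻¹ ∙ (a ∙ b))       ≈⟨ assoc _ _ _ ⟨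
    ((b ∙ a) ∙ (b ∙ a) ⁻¹) ∙ (a ∙ b)       ≈⟨ ∙-congʳ (inverseʳ _) ⟩
    ε ∙ (a ∙ b)                            ≈⟨ identityˡ _ ⟩
    a ∙ b                                  ∎

  involution-resp : ∀ {a b} → a ≈ b → Involution a → Involution b
  involution-resp a≈b (a² , a≉ε) =
    ≈-trans (∙-cong (≈-sym a≈b) (≈-sym a≈b)) a² , λ b≈ε → a≉ε (≈-trans a≈b b≈ε)

  -- Reduces (R2) on a line to one product. The reverse order follows from `ba = (ac)(cb) = ab`, and
  -- two equal involutions would make the third trivial.
  lineOfInvolutions : ∀ {a b c} → Involution a → Involution b → Involution c → a ∙ b ≈ c →
      (¬ a ≈ b) × (¬ b ≈ c) × (¬ a ≈ c)
    × (a ∙ b ≈ c) × (b ∙ a ≈ c) × (b ∙ c ≈ a) × (c ∙ b ≈ a) × (a ∙ c ≈ b) × (c ∙ a ≈ b)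
  lineOfInvolutions {a} {b} {c} (a² , a≉ε) (b² , b≉ε) (c² , c≉ε) ab =
      (λ a≈b → c≉ε (≈-trans (≈-sym ab) (≈-trans (∙-congʳ a≈b) b²)))
    , (λ b≈c → a≉ε (≈-trans (≈-sym cb) (≈-trans (∙-congˡ b≈c) c²)))
    , (λ a≈c → b≉ε (≈-trans (≈-sym ac) (≈-trans (∙-congʳ a≈c) c²)))
    , ab , ba , bc , cb , ac , ca
    where
    ac : a ∙ c ≈ b
    ac = ≈-trans (∙-congˡ (≈-sym ab)) (≈-trans (≈-sym (assoc a a b)) (≈-trans (∙-congʳ a²) (identityˡ b)))
    cb : c ∙ b ≈ a
    cb = ≈-trans (∙-congʳ (≈-sym ab)) (≈-trans (assoc a b b) (≈-trans (∙-congˡ b²) (identityʳ a)))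
    ba : b ∙ a ≈ c
    ba = begin
      b ∙ a              ≈⟨ ∙-cong ac cb ⟨
      (a ∙ c) ∙ (c ∙ b)  ≈⟨ solve monoid ⟩
      (a ∙ (c ∙ c)) ∙ b  ≈⟨ ∙-congʳ (∙-congˡ c²) ⟩
      (a ∙ ε) ∙ b        ≈⟨ ∙-congʳ (identityʳ a) ⟩
      a ∙ b              ≈⟨ ab ⟩
      c                  ∎
    bc : b ∙ c ≈ a
    bc = ≈-trans (∙-congˡ (≈-sym ba)) (≈-trans (≈-sym (assoc b b a)) (≈-trans (∙-congʳ b²) (identityˡ a)))
    ca : c ∙ a ≈ b
    ca = ≈-trans (∙-congʳ (≈-sym ba)) (≈-trans (assoc b a a) (≈-trans (∙-congˡ a²) (identityʳ b)))

-- Lines of Q and of its spread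

module SpreadLines (s : Setting) where
  open Setting s
  open Geometries s
  open Collinearity s
  open Partitions s
  open Quadrangle s Q (T₁-quads iQ)

  InS⇒Adj : ∀ {a b} → InS a b → Adj a b
  InS⇒Adj (a∈Q , b∈Q , a≢b , ab) = ≢⇒Adj a≢b (sameClass⇒Col (trans a∈Q (sym b∈Q)) ab)

  thirdClass : ∀ {a b c} → LineQ a b c → t₂ a ≡ t₂ b → t₂ c ≡ t₂ a
  thirdClass {a} {b} {c} (_ , _ , _ , a≢b , _ , _ , l , a∈l , b∈l , c∈l) ab =
    proj₁ (quad₂ (t₂ a)) l a b c a≢b a∈l b∈l refl (sym ab) c∈l

  InS-Col⇒class : ∀ {p b v} → Q p → InS b v → Col p b → Col p v → t₂ p ≡ t₂ b
  InS-Col⇒class {p} {b} {v} p∈Q bv@(b∈Q , v∈Q , b≢v , e) pb pv with T₁T₂-line iQ (t₂ b)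
  ... | l , on = proj₂ (proj₁ (on p)
        (noTriangles b≢v (proj₂ (on b) (b∈Q , refl)) (proj₂ (on v) (v∈Q , sym e)) pb pv))

  classMembers : ∀ {a b c x} → LineQ a b c → t₂ a ≡ t₂ b → Q x → t₂ x ≡ t₂ a → x ≡ a ⊎ x ≡ b ⊎ x ≡ c
  classMembers {a} {b} {c} {x} abc@(a∈Q , b∈Q , c∈Q , a≢b , b≢c , a≢c , _) e x∈Q xa with T₁T₂-line iQ (t₂ a)
  ... | l , on = lineMembers a≢b b≢c a≢c (proj₂ (on a) (a∈Q , refl)) (proj₂ (on b) (b∈Q , sym e))
                   (proj₂ (on c) (c∈Q , thirdClass abc e)) x (proj₂ (on x) (x∈Q , xa))

  module MatchedLines {a b c u v w} (abc : LineQ a b c) (uvw : LineQ u v w) (disjoint : Disjoint3 a b c u v w)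
                      (au : InS a u) (bv : InS b v) (cw : InS c w) where

    private
      differ : ∀ {a b c u} → LineQ a b c → InS a u → ¬ (u ≡ a ⊎ u ≡ b ⊎ u ≡ c) → t₂ a ≢ t₂ b
      differ abc (_ , u∈Q , _ , au) u∉abc ab = u∉abc (classMembers abc ab u∈Q (sym au))

      skew : ∀ {a b c v} → LineQ a b c → InS b v → t₂ a ≢ t₂ b → ¬ Col a v
      skew abc@(a∈Q , _) bv ab av = ab (InS-Col⇒class a∈Q bv (Line⇒Col abc) av)

      acb = swap (rotate (rotate abc))

    a≁b : t₂ a ≢ t₂ b
    a≁b = differ abc au λ u∈abc → disjoint u u∈abc (inj₁ refl)

    a≁c : t₂ a ≢ t₂ c
    a≁c ac = a≁b (sym (thirdClass acb ac))

    b≁c : t₂ b ≢ t₂ c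
    b≁c bc = a≁b (thirdClass (rotate abc) bc)

    ¬av : ¬ Col a v
    ¬av = skew abc bv a≁b

    -- The spread lines through `au`, `bv`, `cw` are the columns of a grid with rows `abc` and
    -- `uvw`. The row through `p` is one of these or the third row, which `gridRow` provides.
    transversal : ∀ {p} → Q p → t₂ p ≡ t₂ a → Σ P λ q → Σ P λ r → LineQ p q r × t₂ q ≡ t₂ b × t₂ r ≡ t₂ c
    transversal p∈Q p₂ with third (proj₁ au) (proj₁ (proj₂ au)) (InS⇒Adj au)
                          | third (proj₁ bv) (proj₁ (proj₂ bv)) (InS⇒Adj bv)
                          | third (proj₁ cw) (proj₁ (proj₂ cw)) (InS⇒Adj cw)
    ... | a′ , aua′ | b′ , bvb′ | c′ , cwc′ with classMembers aua′ (proj₂ (proj₂ (proj₂ au))) p∈Q p₂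
    ... | inj₁ refl = b , c , abc , refl , refl
    ... | inj₂ (inj₁ refl) = v , w , uvw , sym (proj₂ (proj₂ (proj₂ bv))) , sym (proj₂ (proj₂ (proj₂ cw)))
    ... | inj₂ (inj₂ refl) = b′ , c′
          , gridRow abc uvw aua′ bvb′ cwc′
              ¬av (skew acb cw a≁c)
              (skew (swap abc) au (≢-sym a≁b)) (skew (rotate abc) cw b≁c)
              (skew (rotate (rotate abc)) au (≢-sym a≁c)) (skew (swap (rotate abc)) bv (≢-sym b≁c))
          , thirdClass bvb′ (proj₂ (proj₂ (proj₂ bv))) , thirdClass cwc′ (proj₂ (proj₂ (proj₂ cw)))

-- Representations of Y

module YRepresentation (s : Setting) (g : GroupSetting) (φ : Geometries.YPt s → GroupSetting.Carrier g)
  (φ-rep : GroupSetting.IsNonAbelianRep g (Geometries.ValidY s) (Geometries.YLine s) (GroupSetting.M g) φ) where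
  open Setting s
  open Geometries s
  open GroupSetting g renaming (refl to ≈-refl; sym to ≈-sym; trans to ≈-trans)
  open Collinearity s
  open Quadrangle s Q (T₁-quads iQ)
  open Commuting R

  λ₀-central : ∀ r → Comm λ₀ r
  λ₀-central r = proj₂ (proj₂ (proj₁ (proj₂ (proj₂ (proj₁ R-ext)))) λ₀ (proj₂ R′ λ₀ (inj₂ ≈-refl))) r tt

  comm-or-twist : ∀ a b → Comm a b ⊎ a ∙ b ≈ (b ∙ a) ∙ λ₀
  comm-or-twist a b with proj₁ R′ [ a , b ] (gen (a , b , tt , tt , ≈-refl))
  ... | inj₁ ab = inj₁ (≈-trans (≈-sym (commutator a b)) (≈-trans (∙-congˡ ab) (identityʳ _)))
  ... | inj₂ ab = inj₂ (≈-trans (≈-sym (commutator a b)) (∙-congˡ ab))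

  φ-involution : ∀ {p} → ValidY p → Involution (φ p)
  φ-involution = proj₁ (proj₁ φ-rep) _

  φ∈M : ∀ {p} → ValidY p → M (φ p)
  φ∈M p = proj₁ (proj₁ (proj₂ (proj₁ φ-rep))) _ (gen (_ , p , ≈-refl))

  M-generated : ∀ {m} → M m → Gen (λ x → Σ YPt λ p → ValidY p × x ≈ φ p) m
  M-generated = proj₂ (proj₁ (proj₂ (proj₁ φ-rep))) _

  φ-line : ∀ {p q r} → YLine p q r → φ p ∙ φ q ≈ φ r
  φ-line l = proj₁ (proj₂ (proj₂ (proj₂ (proj₂ (proj₂ (proj₁ φ-rep)) _ _ _ l))))

  module _ (y : P → YPt) (lines : ∀ {a b c} → LineQ a b c → YLine (y a) (y b) (y c)) where

    φ-layer-comm : ∀ {a b} → Q a → Q b → Comm (φ (y a)) (φ (y b))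
    φ-layer-comm {a} {b} a∈Q b∈Q with Col? a b
    ... | yes (inj₁ refl) = ≈-refl
    ... | yes (inj₂ ab) with third a∈Q b∈Q ab
    ... | c , abc = ≈-trans (φ-line (lines abc)) (≈-sym (φ-line (lines (swap abc))))
    φ-layer-comm {a} {b} a∈Q b∈Q | no ¬ab = grid⇒comm (on row₁) (on row₂) (on row₃) (on col₁) (on col₂) (on col₃)
      where
      open Grid3 (gridOn a∈Q b∈Q ¬ab)
      on : ∀ {a b c} → LineQ a b c → φ (y a) ∙ φ (y b) ≈ φ (y c)
      on abc = φ-line (lines abc)

  -- The relation to which `Spread` is applied; non-collinear `x`, `y` correspond to points `x` and
  -- `ȳ` at distance 3 in Y.
  F : P → P → Set
  F x y = Comm (φ (y₁ x)) (φ (y₂ y))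

  layer₁₃ : ∀ {x y} → Q x → Q y → F x y → Comm (φ (y₁ x)) (φ (y₃ y))
  layer₁₃ x∈Q y∈Q xȳ = comm-respʳ (φ-line (yL4 y∈Q)) (comm-∙ (φ-layer-comm y₁ yL1 x∈Q y∈Q) xȳ)

  -- The layers are exchanged through the third one: `x` commutes with `y̿ = yȳ`, so `x̄ = xx̿`
  -- commutes with `y̿`, so `x̄` commutes with `y = y̿ȳ`. Elements of one layer commute throughout.
  F-sym : ∀ {x y} → Q x → Q y → F x y → F y x
  F-sym {x} {y} x∈Q y∈Q xȳ = ≈-sym (comm-respʳ y̿ȳ
      (comm-∙ (≈-sym (comm-respʳ xx̿ (comm-∙ (≈-sym (layer₁₃ x∈Q y∈Q xȳ)) (φ-layer-comm y₃ yL3 y∈Q x∈Q))))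
              (φ-layer-comm y₂ yL2 x∈Q y∈Q)))
    where
    y̿ȳ : φ (y₃ y) ∙ φ (y₂ y) ≈ φ (y₁ y)
    y̿ȳ = proj₁ (proj₂ (proj₂ (proj₂ (proj₂ (proj₂ (proj₂
           (lineOfInvolutions (φ-involution y∈Q) (φ-involution y∈Q) (φ-involution y∈Q) (φ-line (yL4 y∈Q)))))))))
    xx̿ : φ (y₁ x) ∙ φ (y₃ x) ≈ φ (y₂ x)
    xx̿ = proj₁ (proj₂ (proj₂ (proj₂ (proj₂ (proj₂ (proj₂ (proj₂
           (lineOfInvolutions (φ-involution x∈Q) (φ-involution x∈Q) (φ-involution x∈Q) (φ-line (yL4 x∈Q))))))))))

  F-col : ∀ {x y} → Q x → Q y → Col x y → F x y
  F-col x∈Q y∈Q (inj₁ refl) = ≈-trans (φ-line (yL4 x∈Q)) (≈-sym (proj₁ (proj₂ (proj₂ (proj₂ (proj₂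
    (lineOfInvolutions (φ-involution x∈Q) (φ-involution x∈Q) (φ-involution x∈Q) (φ-line (yL4 x∈Q)))))))))
  F-col x∈Q y∈Q (inj₂ xy) with third x∈Q y∈Q xy
  -- The three copies of the line `xyz`, joined by the lines of type (L4), form a grid in Y.
  ... | z , xyz = grid⇒comm (φ-line (yL1 (swap xyz))) (φ-line (yL2 (swap xyz))) (φ-line (yL3 (swap xyz)))
                    (φ-line (yL4 y∈Q)) (φ-line (yL4 x∈Q)) (φ-line (yL4 (proj₁ (proj₂ (proj₂ xyz)))))

  F-line : ∀ {x y y′ z} → Q x → LineQ y y′ z → F x y → F x y′ → F x z
  F-line x∈Q yy′z xȳ xȳ′ = comm-respʳ (φ-line (yL2 yy′z)) (comm-∙ xȳ xȳ′)

  open Spread F F-sym F-col F-line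

  φ-twist : ∀ {x y} → Q x → Q y → ¬ Col x y → φ (y₂ x) ∙ φ (y₁ y) ≈ (φ (y₁ y) ∙ φ (y₂ x)) ∙ λ₀
  φ-twist {x} {y} x∈Q y∈Q ¬xy with comm-or-twist (φ (y₂ x)) (φ (y₁ y))
  ... | inj₂ twist = twist
  ... | inj₁ comm = ⊥-elim (M-abelian (proj₂ φ-rep))
    where
    all-F : ∀ {x y} → Q x → Q y → F x y
    all-F = spread y∈Q x∈Q (¬xy ∘ Col-sym) (≈-sym comm)
    layer₂₃ : ∀ {x y} → Q x → Q y → Comm (φ (y₂ x)) (φ (y₃ y))
    layer₂₃ x∈Q y∈Q = comm-respʳ (φ-line (yL4 y∈Q))
      (comm-∙ (≈-sym (all-F y∈Q x∈Q)) (φ-layer-comm y₂ yL2 x∈Q y∈Q))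
    all-comm : ∀ p q → ValidY p → ValidY q → Comm (φ p) (φ q)
    all-comm (y₁ _) (y₁ _) p q = φ-layer-comm y₁ yL1 p q
    all-comm (y₁ _) (y₂ _) p q = all-F p q
    all-comm (y₁ _) (y₃ _) p q = layer₁₃ p q (all-F p q)
    all-comm (y₂ _) (y₁ _) p q = ≈-sym (all-F q p)
    all-comm (y₂ _) (y₂ _) p q = φ-layer-comm y₂ yL2 p q
    all-comm (y₂ _) (y₃ _) p q = layer₂₃ p q
    all-comm (y₃ _) (y₁ _) p q = ≈-sym (layer₁₃ q p (all-F q p))
    all-comm (y₃ _) (y₂ _) p q = ≈-sym (layer₂₃ q p)
    all-comm (y₃ _) (y₃ _) p q = φ-layer-comm y₃ yL3 p q
    M-abelian : ¬ NonAbelian M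
    M-abelian (a , b , a∈M , b∈M , ¬ab) = ¬ab (gen-abelian
      (λ { (p , p∈Y , x≈) (q , q∈Y , y≈) → comm-respʳ (≈-sym y≈)
             (≈-sym (comm-respʳ (≈-sym x≈) (≈-sym (all-comm p q p∈Y q∈Y)))) })
      (M-generated a∈M) (M-generated b∈M))

module Extension (s : Setting) (g : GroupSetting)
  (φ : Geometries.YPt s → GroupSetting.Carrier g)
  (δ : Setting.P s → GroupSetting.Carrier g)
  (ψ : Geometries.SPt s → GroupSetting.Carrier g)
  (φ-rep : GroupSetting.IsNonAbelianRep g (Geometries.ValidY s) (Geometries.YLine s) (GroupSetting.M g) φ)
  (isDelta : Construction.IsDelta s g δ)
  (isPsi : Construction.IsPsi s g φ δ ψ) where
  open Setting s
  open Geometries s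
  open GroupSetting g renaming (refl to ≈-refl; sym to ≈-sym; trans to ≈-trans)
  open Collinearity s
  open Partitions s
  open Subquadrangles s
  open Quadrangle s Q (T₁-quads iQ)
  open SpreadLines s
  open Commuting R
  open YRepresentation s g φ φ-rep
  open GroupProperties R
  open SetoidReasoning setoid

  δ∈N : ∀ {x} → Q x → N (δ x)
  δ∈N x∈Q = proj₁ (proj₁ isDelta _ x∈Q)

  δ² : ∀ {x} → Q x → δ x ∙ δ x ≈ ε
  δ² x∈Q = proj₁ (proj₂ (proj₁ isDelta _ x∈Q))

  δ-line : ∀ {x y z} → LineQ x y z →
           (t₂ x ≡ t₂ y → δ z ≈ δ x ∙ δ y) × (t₂ x ≢ t₂ y → δ z ≈ (δ x ∙ δ y) ∙ λ₀)
  δ-line = proj₁ (proj₂ (proj₂ (proj₂ isDelta))) _ _ _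

  -- Otherwise `δ x` would be 1 or λ. It is an involution, so not 1; it fails to commute with `δ y`
  -- for `y` not collinear with `x`, so it is not the central λ.
  δ∉M : ∀ {x} → Q x → ¬ M (δ x)
  δ∉M {x} x∈Q δx∈M with proj₁ M∩N (δ x) (δx∈M , δ∈N x∈Q)
  ... | inj₁ δx≈ε = proj₂ (proj₂ (proj₁ isDelta x x∈Q)) δx≈ε
  ... | inj₂ δx≈λ₀ with nonCollinear x∈Q
  ... | y , y∈Q , ¬xy = ¬xy (proj₁ (proj₁ (proj₂ (proj₂ isDelta)) x y x∈Q y∈Q)
        (≈-trans (∙-congʳ δx≈λ₀) (≈-trans (λ₀-central (δ y)) (∙-congˡ (≈-sym δx≈λ₀)))))

  M-∙ : ∀ {a b} → M a → M b → M (a ∙ b)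
  M-∙ = proj₁ (proj₂ (proj₁ (proj₁ M-ext))) _ _

  M-⁻¹ : ∀ {a} → M a → M (a ⁻¹)
  M-⁻¹ = proj₁ (proj₂ (proj₂ (proj₁ (proj₁ M-ext)))) _

  M-resp : ∀ {a b} → a ≈ b → M a → M b
  M-resp = proj₂ (proj₂ (proj₂ (proj₁ (proj₁ M-ext)))) _ _

  δ-comm : ∀ {x p q} → Q x → ValidY p → ValidY q → Comm (δ x) (φ p ∙ φ q)
  δ-comm x∈Q p q = ≈-sym (MN-commute _ _ (M-∙ (φ∈M p) (φ∈M q)) (δ∈N x∈Q))

  ψ-Y : ∀ q → ValidY q → ψ (embed q) ≈ φ q
  ψ-Y = proj₁ isPsi

  ψ₄ : ∀ {a b i u} → InS a b → Q u → t₂ u ≡ t₂ a → εQ u ≡ i → ψ (s₄ a b i) ≈ (φ (y₁ b) ∙ φ (y₂ a)) ∙ δ u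
  ψ₄ = proj₂ isPsi _ _ _ _

  ψ₄-involution : ∀ {a b u} → InS a b → Q u → Involution ((φ (y₁ b) ∙ φ (y₂ a)) ∙ δ u)
  ψ₄-involution {a} {b} {u} ab@(a∈Q , b∈Q , _) u∈Q = square-ε , nontrivial
    where
    square-ε : ((φ (y₁ b) ∙ φ (y₂ a)) ∙ δ u) ∙ ((φ (y₁ b) ∙ φ (y₂ a)) ∙ δ u) ≈ ε
    square-ε = ≈-trans
      (interchange-comm (≈-sym (F-col b∈Q a∈Q (inj₂ (Adj-sym (InS⇒Adj ab))))) (δ-comm u∈Q b∈Q a∈Q))
      (≈-trans (∙-cong (∙-cong (proj₁ (φ-involution b∈Q)) (proj₁ (φ-involution a∈Q))) (δ² u∈Q))
               (≈-trans (identityʳ _) (identityʳ _)))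
    nontrivial : ¬ (φ (y₁ b) ∙ φ (y₂ a)) ∙ δ u ≈ ε
    -- A trivial product would make `δ u` the inverse of an element of `M`.
    nontrivial e = δ∉M u∈Q (M-resp (≈-sym (inverseʳ-unique _ _ e)) (M-⁻¹ (M-∙ (φ∈M b∈Q) (φ∈M a∈Q))))

  ψ-involution : ∀ p → ValidS p → Involution (ψ p)
  ψ-involution (s₁ x) x∈Q = involution-resp (≈-sym (ψ-Y (y₁ x) x∈Q)) (φ-involution x∈Q)
  ψ-involution (s₂ x) x∈Q = involution-resp (≈-sym (ψ-Y (y₂ x) x∈Q)) (φ-involution x∈Q)
  ψ-involution (s₃ x) x∈Q = involution-resp (≈-sym (ψ-Y (y₃ x) x∈Q)) (φ-involution x∈Q)
  ψ-involution (s₄ a b i) ab with ε-spread-surjective (t₂ a) i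
  ... | u , u∈Q , u₂ , e = involution-resp (≈-sym (ψ₄ ab u∈Q u₂ e)) (ψ₄-involution ab u∈Q)

  LineS⇒InS : ∀ {a b c} → LineS a b c → InS a b × InS b c × InS c a
  LineS⇒InS (abc@(a∈Q , b∈Q , c∈Q , a≢b , b≢c , a≢c , _) , ab) =
      (a∈Q , b∈Q , a≢b , ab) , (b∈Q , c∈Q , b≢c , trans (sym ab) (sym ca)) , (c∈Q , a∈Q , ≢-sym a≢c , ca)
    where ca = thirdClass abc ab

  InS-sym : ∀ {a b} → InS a b → InS b a
  InS-sym (a∈Q , b∈Q , a≢b , ab) = b∈Q , a∈Q , ≢-sym a≢b , sym ab

  SLine-valid : ∀ {p q r} → SLine p q r → ValidS p × ValidS q × ValidS r
  SLine-valid (L1 (x , y , z , _)) = x , y , z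
  SLine-valid (L2 (x , y , z , _)) = x , y , z
  SLine-valid (L3 (x , y , z , _)) = x , y , z
  SLine-valid (L4 x) = x , x , x
  SLine-valid (L5 abc) with LineS⇒InS abc
  ... | ab , bc , ca = proj₁ ab , ab , InS-sym ca
  SLine-valid (L6 abc) with LineS⇒InS abc
  ... | ab , bc , ca = proj₁ ab , InS-sym ab , ca
  SLine-valid (L7 abc) with LineS⇒InS abc
  ... | ab , bc , ca = proj₁ ab , bc , InS-sym bc
  SLine-valid (L8 abc _ _ _) = LineS⇒InS abc
  SLine-valid (L9 _ _ _ _ _ _ au bv cw _ _) = au , bv , cw

  ψ-Y-line : ∀ p q r → ValidY p → ValidY q → ValidY r → YLine p q r → ψ (embed p) ∙ ψ (embed q) ≈ ψ (embed r)
  ψ-Y-line p q r p∈Y q∈Y r∈Y l =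
    ≈-trans (∙-cong (ψ-Y p p∈Y) (ψ-Y q q∈Y)) (≈-trans (φ-line l) (≈-sym (ψ-Y r r∈Y)))

  ψ-L5 : ∀ {a b c i} → LineS a b c → ψ (s₁ a) ∙ ψ (s₄ a b i) ≈ ψ (s₄ a c i)
  ψ-L5 {a} {b} {c} {i} abcS@(abc@(a∈Q , _) , _) with LineS⇒InS abcS | ε-spread-surjective (t₂ a) i
  ... | ab , bc , ca | u , u∈Q , u₂ , e = begin
    ψ (s₁ a) ∙ ψ (s₄ a b i)                           ≈⟨ ∙-cong (ψ-Y (y₁ a) a∈Q) (ψ₄ ab u∈Q u₂ e) ⟩
    φ (y₁ a) ∙ ((φ (y₁ b) ∙ φ (y₂ a)) ∙ δ u)          ≈⟨ assoc-into _ _ _ _ ⟩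
    ((φ (y₁ a) ∙ φ (y₁ b)) ∙ φ (y₂ a)) ∙ δ u          ≈⟨ ∙-congʳ (∙-congʳ (φ-line (yL1 abc))) ⟩
    (φ (y₁ c) ∙ φ (y₂ a)) ∙ δ u                       ≈⟨ ψ₄ (InS-sym ca) u∈Q u₂ e ⟨
    ψ (s₄ a c i)                                      ∎

  ψ-L6 : ∀ {a b c i} → LineS a b c → ψ (s₂ a) ∙ ψ (s₄ b a i) ≈ ψ (s₄ c a i)
  ψ-L6 {a} {b} {c} {i} abcS@(abc@(a∈Q , _) , _) with LineS⇒InS abcS | ε-spread-surjective (t₂ a) i
  ... | ab , bc , ca | u , u∈Q , u₂ , e = begin
    ψ (s₂ a) ∙ ψ (s₄ b a i)                           ≈⟨ ∙-cong (ψ-Y (y₂ a) a∈Q) (ψ₄ (InS-sym ab) u∈Q (trans u₂ (proj₂ (proj₂ (proj₂ ab)))) e) ⟩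
    φ (y₂ a) ∙ ((φ (y₁ a) ∙ φ (y₂ b)) ∙ δ u)          ≈⟨ assoc-into _ _ _ _ ⟩
    ((φ (y₂ a) ∙ φ (y₁ a)) ∙ φ (y₂ b)) ∙ δ u          ≈⟨ ∙-congʳ (∙-congʳ (F-col a∈Q a∈Q (inj₁ refl))) ⟨
    ((φ (y₁ a) ∙ φ (y₂ a)) ∙ φ (y₂ b)) ∙ δ u          ≈⟨ ∙-congʳ (assoc _ _ _) ⟩
    (φ (y₁ a) ∙ (φ (y₂ a) ∙ φ (y₂ b))) ∙ δ u          ≈⟨ ∙-congʳ (∙-congˡ (φ-line (yL2 abc))) ⟩
    (φ (y₁ a) ∙ φ (y₂ c)) ∙ δ u                       ≈⟨ ψ₄ ca u∈Q (trans u₂ (sym (proj₂ (proj₂ (proj₂ ca))))) e ⟨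
    ψ (s₄ c a i)                                      ∎

  ψ-L7 : ∀ {a b c i} → LineS a b c → ψ (s₃ a) ∙ ψ (s₄ b c i) ≈ ψ (s₄ c b i)
  ψ-L7 {a} {b} {c} {i} abcS@(abc@(a∈Q , b∈Q , c∈Q , _) , _) with LineS⇒InS abcS | ε-spread-surjective (t₂ b) i
  ... | ab , bc , ca | u , u∈Q , u₂ , e = begin
    ψ (s₃ a) ∙ ψ (s₄ b c i)                                       ≈⟨ ∙-cong (ψ-Y (y₃ a) a∈Q) (ψ₄ bc u∈Q u₂ e) ⟩
    φ (y₃ a) ∙ ((φ (y₁ c) ∙ φ (y₂ b)) ∙ δ u)                      ≈⟨ ∙-congʳ (φ-line (yL4 a∈Q)) ⟨
    (φ (y₁ a) ∙ φ (y₂ a)) ∙ ((φ (y₁ c) ∙ φ (y₂ b)) ∙ δ u)         ≈⟨ interchange-left (≈-sym (F-col c∈Q a∈Q (inj₂ (InS⇒Adj ca)))) ⟩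
    ((φ (y₁ a) ∙ φ (y₁ c)) ∙ (φ (y₂ a) ∙ φ (y₂ b))) ∙ δ u         ≈⟨ ∙-congʳ (∙-cong (φ-line (yL1 (swap (rotate (rotate abc))))) (φ-line (yL2 abc))) ⟩
    (φ (y₁ b) ∙ φ (y₂ c)) ∙ δ u                                   ≈⟨ ψ₄ (InS-sym bc) u∈Q (trans u₂ (proj₂ (proj₂ (proj₂ bc)))) e ⟨
    ψ (s₄ c b i)                                                  ∎

  -- Distinct values of ε make `u`, `v`, `w` the three points of one line of S, so δ multiplies
  -- without a sign; on the φ side `ā` and `c` commute because `a` and `c` are collinear.
  ψ-L8 : ∀ {a b c i j k} → LineS a b c → i ≢ j → j ≢ k → i ≢ k → ψ (s₄ a b i) ∙ ψ (s₄ b c j) ≈ ψ (s₄ c a k)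
  ψ-L8 {a} {b} {c} {i} {j} {k} abcS@(abc@(a∈Q , b∈Q , c∈Q , _) , _) i≢j j≢k i≢k
    with LineS⇒InS abcS | ε-spread-surjective (t₂ a) i | ε-spread-surjective (t₂ a) j | ε-spread-surjective (t₂ a) k
  ... | ab , bc , ca | u , u∈Q , u₂ , refl | v , v∈Q , v₂ , refl | w , w∈Q , w₂ , refl = begin
    ψ (s₄ a b i) ∙ ψ (s₄ b c j)                                            ≈⟨ ∙-cong (ψ₄ ab u∈Q u₂ refl) (ψ₄ bc v∈Q (trans v₂ (proj₂ (proj₂ (proj₂ ab)))) refl) ⟩
    ((φ (y₁ b) ∙ φ (y₂ a)) ∙ δ u) ∙ ((φ (y₁ c) ∙ φ (y₂ b)) ∙ δ v)          ≈⟨ interchange-comm (≈-sym (F-col c∈Q a∈Q (inj₂ (InS⇒Adj ca)))) (δ-comm u∈Q c∈Q b∈Q) ⟩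
    ((φ (y₁ b) ∙ φ (y₁ c)) ∙ (φ (y₂ a) ∙ φ (y₂ b))) ∙ (δ u ∙ δ v)          ≈⟨ ∙-cong (∙-cong (φ-line (yL1 (rotate abc))) (φ-line (yL2 abc))) (≈-sym (proj₁ (δ-line uvw) (trans u₂ (sym v₂)))) ⟩
    (φ (y₁ a) ∙ φ (y₂ c)) ∙ δ w                                            ≈⟨ ψ₄ ca w∈Q (trans w₂ (sym (proj₂ (proj₂ (proj₂ ca))))) refl ⟨
    ψ (s₄ c a k)                                                           ∎
    where
    uvw : LineQ u v w
    uvw with T₁T₂-line iQ (t₂ a)
    ... | l , on = u∈Q , v∈Q , w∈Q , i≢j ∘ cong εQ , j≢k ∘ cong εQ , i≢k ∘ cong εQ
                 , l , proj₂ (on u) (u∈Q , u₂) , proj₂ (on v) (v∈Q , v₂) , proj₂ (on w) (w∈Q , w₂)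

  -- The sign from the non-collinear pair a, v cancels the sign from the line pqr outside S.
  ψ-L9 : ∀ {a b c u v w i j k} → LineQ a b c → LineQ u v w → Disjoint3 a b c u v w →
         InS a u → InS b v → InS c w → j ≡ i ⊕ θ (t₂ a) (t₂ b) → k ≡ i ⊕ θ (t₂ a) (t₂ c) →
         ψ (s₄ a u i) ∙ ψ (s₄ b v j) ≈ ψ (s₄ c w k)
  ψ-L9 {a} {b} {c} {u} {v} {w} {i} {j} {k} abc uvw disjoint au bv cw j≡ k≡ with ε-spread-surjective (t₂ a) i
  ... | p , p∈Q , p₂ , refl with MatchedLines.transversal abc uvw disjoint au bv cw p∈Q p₂
  ... | q , r , pqr@(_ , q∈Q , r∈Q , _) , q₂ , r₂ = begin
    ψ (s₄ a u i) ∙ ψ (s₄ b v j)                                            ≈⟨ ∙-cong (ψ₄ au p∈Q p₂ refl) (ψ₄ bv q∈Q q₂ ε-q) ⟩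
    ((φ (y₁ u) ∙ φ (y₂ a)) ∙ δ p) ∙ ((φ (y₁ v) ∙ φ (y₂ b)) ∙ δ q)          ≈⟨ interchange λ₀-central (φ-twist (proj₁ au) (proj₁ (proj₂ bv)) ¬av) (δ-comm p∈Q (proj₁ (proj₂ bv)) (proj₁ bv)) ⟩
    ((φ (y₁ u) ∙ φ (y₁ v)) ∙ (φ (y₂ a) ∙ φ (y₂ b))) ∙ ((δ p ∙ δ q) ∙ λ₀)   ≈⟨ ∙-cong (∙-cong (φ-line (yL1 uvw)) (φ-line (yL2 abc))) (≈-sym (proj₂ (δ-line pqr) p≁q)) ⟩
    (φ (y₁ w) ∙ φ (y₂ c)) ∙ δ r                                            ≈⟨ ψ₄ cw r∈Q r₂ ε-r ⟨
    ψ (s₄ c w k)                                                           ∎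
    where
    open MatchedLines abc uvw disjoint au bv cw using (a≁b; a≁c; ¬av)
    p≁q : t₂ p ≢ t₂ q
    p≁q e = a≁b (trans (sym p₂) (trans e q₂))
    p≁r : t₂ p ≢ t₂ r
    p≁r e = a≁c (trans (sym p₂) (trans e r₂))
    ε-q : εQ q ≡ j
    ε-q = trans (ε-shift p∈Q q∈Q (Line⇒Adj pqr) p≁q) (trans (cong₂ (λ x y → εQ p ⊕ θ x y) p₂ q₂) (sym j≡))
    ε-r : εQ r ≡ k
    ε-r = trans (ε-shift p∈Q r∈Q (Adj-sym (Line⇒Adj (rotate (rotate pqr)))) p≁r)
                (trans (cong₂ (λ x y → εQ p ⊕ θ x y) p₂ r₂) (sym k≡))

  ψ-line : ∀ {p q r} → SLine p q r → ψ p ∙ ψ q ≈ ψ r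
  ψ-line (L1 xyz@(x , y , z , _)) = ψ-Y-line (y₁ _) (y₁ _) (y₁ _) x y z (yL1 xyz)
  ψ-line (L2 xyz@(x , y , z , _)) = ψ-Y-line (y₂ _) (y₂ _) (y₂ _) x y z (yL2 xyz)
  ψ-line (L3 xyz@(x , y , z , _)) = ψ-Y-line (y₃ _) (y₃ _) (y₃ _) x y z (yL3 xyz)
  ψ-line (L4 x) = ψ-Y-line (y₁ _) (y₂ _) (y₃ _) x x x (yL4 x)
  ψ-line (L5 abc) = ψ-L5 abc
  ψ-line (L6 abc) = ψ-L6 abc
  ψ-line (L7 abc) = ψ-L7 abc
  ψ-line (L8 abc i≢j j≢k i≢k) = ψ-L8 abc i≢j j≢k i≢k
  ψ-line (L9 abc uvw disjoint _ _ _ au bv cw j≡ k≡) = ψ-L9 abc uvw disjoint au bv cw j≡ k≡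

  Generated : Carrier → Set
  Generated = Gen (λ x → Σ SPt λ p → ValidS p × x ≈ ψ p)

  embed-valid : ∀ q → ValidY q → ValidS (embed q)
  embed-valid (y₁ _) x∈Q = x∈Q
  embed-valid (y₂ _) x∈Q = x∈Q
  embed-valid (y₃ _) x∈Q = x∈Q

  φ-generated : ∀ q → ValidY q → Generated (φ q)
  φ-generated q q∈Y = gen (embed q , embed-valid q q∈Y , ≈-sym (ψ-Y q q∈Y))

  -- With another point `y` on the spread line of `x`, solving the definition of ψ at `(x, y, εQ x)`
  -- for `δ x` expresses it by values of ψ and φ.
  δ-generated : ∀ x → Q x → Generated (δ x)
  δ-generated x x∈Q with spreadPartner x
  ... | y , y₁′ , y₂′ , xy = resp (≈-sym (y≈x\\z _ _ _ (≈-sym (ψ₄ x∥y x∈Q refl refl))))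
        (mul (inv (mul (φ-generated (y₁ y) y∈Q) (φ-generated (y₂ x) x∈Q)))
             (gen (s₄ x y (εQ x) , x∥y , ≈-refl)))
    where
    y∈Q : Q y
    y∈Q = trans y₁′ x∈Q
    x∥y : InS x y
    x∥y = x∈Q , y∈Q , proj₁ xy , sym y₂′

  ψ-generates : ∀ r → Generated r
  ψ-generates r with R=MN r
  ... | m , n , m∈M , n∈N , r≈mn = resp (≈-sym r≈mn) (mul
        (gen-mono (λ { (q , q∈Y , x≈φq) → resp (≈-sym x≈φq) (φ-generated q q∈Y) }) (M-generated m∈M))
        (gen-mono (λ { (x , x∈Q , r≈δx) → resp (≈-sym r≈δx) (δ-generated x x∈Q) })
          (proj₂ (proj₂ (proj₂ (proj₂ (proj₂ isDelta)))) n n∈N)))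

  ψ-rep : IsNonAbelianRep ValidS SLine (λ _ → ⊤) ψ
  ψ-rep = ( ψ-involution
          , ((λ _ _ → tt) , (λ r _ → ψ-generates r))
          , λ p q r pqr → let p∈S , q∈S , r∈S = SLine-valid pqr in
              lineOfInvolutions (ψ-involution p p∈S) (ψ-involution q q∈S) (ψ-involution r r∈S) (ψ-line pqr))
        -- A non-commuting pair of `M` is one of the whole group.
        , (let a , b , _ , _ , ¬ab = proj₂ φ-rep in a , b , tt , tt , ¬ab)

theorem5p3 : (s : Setting) (g : GroupSetting) →
    let open Setting s
        open Geometries s
        open GroupSetting g
        open Construction s g
    in (φ : YPt → Carrier) (δ : P → Carrier) (ψ : SPt → Carrier) →
       IsNonAbelianRep ValidY YLine M φ →
       IsDelta δ →
       IsPsi φ δ ψ →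
       IsNonAbelianRep ValidS SLine (λ _ → ⊤) ψ
theorem5p3 s g φ δ ψ φ-rep isDelta isPsi = Extension.ψ-rep s g φ δ ψ φ-rep isDelta isPsi
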